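{- Let $H$ be a simple planar graph with $\Delta(H)\le4$. Then there exists a $4$-regular simple planar graph $G$ containing $H$ as a subgraph if and only if there exists a $4$-regular planar multigraph $G'$ containing $H$ as a subgraph with $V(G')=V(H)$.
   Context: Multigraphs may have multiple edges and loops (a loop contributing $2$ to the degree of its vertex). $\Delta(H)$ is the maximum degree of $H$. -}

module Defs where

open import Data.Nat using (ℕ; zero; suc; _+_; _≤_)
open import Data.Fin using (Fin; _≟_)
open import Data.Bool using (Bool; true; false; not; if_then_else_)
open import Data.Product using (Σ; ∃; _×_; _,_; proj₁; proj₂)
open import Data.Sum using (_⊎_)
open import Data.List using (List; length; map; allFin)
open import Data.Nat.ListAction using (sum)
open import Data.List.Relation.Unary.All using (All)
open import Data.List.Relation.Unary.Any using (Any)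
open import Data.List.Relation.Unary.AllPairs using (AllPairs)
open import Function.Bundles using (_↔_; Inverse)
open import Function.Definitions using (Injective)
open import Relation.Binary.PropositionalEquality using (_≡_; _≢_)
open import Relation.Nullary using (¬_; does)

record Multigraph (n : ℕ) : Set where
  field
    m    : ℕ
    ends : Fin m → Fin n × Fin n
open Multigraph public

SameEnds : ∀ {n} → Fin n × Fin n → Fin n × Fin n → Set
SameEnds (a , b) (c , d) = (a ≡ c × b ≡ d) ⊎ (a ≡ d × b ≡ c)

endsAt : ∀ {n} (G : Multigraph n) → Fin n → Fin (m G) → ℕ
endsAt G v e =
  (if does (proj₁ (ends G e) ≟ v) then 1 else 0) +
  (if does (proj₂ (ends G e) ≟ v) then 1 else 0)

degree : ∀ {n} (G : Multigraph n) → Fin n → ℕ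
degree G v = sum (map (endsAt G v) (allFin (m G)))

MaxDegreeAtMost : ∀ {n} → ℕ → Multigraph n → Set
MaxDegreeAtMost k G = ∀ v → degree G v ≤ k

Regular : ∀ {n} → ℕ → Multigraph n → Set
Regular k G = ∀ v → degree G v ≡ k

Simple : ∀ {n} → Multigraph n → Set
Simple G =
  (∀ e → proj₁ (ends G e) ≢ proj₂ (ends G e)) ×
  (∀ e e′ → e ≢ e′ → ¬ SameEnds (ends G e) (ends G e′))

Subgraph : ∀ {n N} → Multigraph n → Multigraph N → Set
Subgraph {n} {N} H G =
  Σ (Fin n → Fin N) λ f → Injective _≡_ _≡_ f ×
  Σ (Fin (m H) → Fin (m G)) λ g → Injective _≡_ _≡_ g ×
  (∀ e → SameEnds (f (proj₁ (ends H e)) , f (proj₂ (ends H e))) (ends G (g e)))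

-- Planarity via rotation systems (Heffter–Edmonds): a multigraph is
-- planar iff it has a rotation system all of whose connected components
-- have Euler characteristic 2 (genus 0).

Dart : ∀ {n} → Multigraph n → Set
Dart G = Fin (m G) × Bool

head : ∀ {n} (G : Multigraph n) → Dart G → Fin n
head G (e , false) = proj₁ (ends G e)
head G (e , true)  = proj₂ (ends G e)

α : ∀ {n} (G : Multigraph n) → Dart G → Dart G
α G (e , b) = (e , not b)

iter : ∀ {A : Set} → (A → A) → ℕ → A → A
iter f zero    x = x
iter f (suc k) x = f (iter f k x)

Reach : ∀ {A : Set} → (A → A) → A → A → Set
Reach f x y = ∃ λ k → iter f k x ≡ y

data Conn {A : Set} (σ a : A → A) (x : A) : A → Set where
  here  : Conn σ a x x
  stepσ : ∀ {y} → Conn σ a x y → Conn σ a x (σ y)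
  stepα : ∀ {y} → Conn σ a x y → Conn σ a x (a y)

NumClasses : ∀ {A : Set} → (A → A → Set) → (A → Set) → ℕ → Set
NumClasses {A} R P k =
  Σ (List A) λ reps →
    (length reps ≡ k) ×
    All P reps ×
    AllPairs (λ x y → ¬ R x y) reps ×
    (∀ x → P x → Any (λ r → R r x) reps)

record PlanarRotation {n} (G : Multigraph n) : Set where
  field
    rot        : Dart G ↔ Dart G
  σ : Dart G → Dart G
  σ = Inverse.to rot
  φ : Dart G → Dart G
  φ d = σ (α G d)
  field
    rot-head   : ∀ d → head G (σ d) ≡ head G d
    rot-cyclic : ∀ d d′ → head G d ≡ head G d′ → Reach σ d d′
    euler      : ∀ d₀ → Σ ℕ λ V → Σ ℕ λ E → Σ ℕ λ F →
                   NumClasses (Reach σ) (Conn σ (α G) d₀) V ×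
                   NumClasses (Reach (α G)) (Conn σ (α G) d₀) E ×
                   NumClasses (Reach φ) (Conn σ (α G) d₀) F ×
                   (V + F ≡ E + 2)

Planar : ∀ {n} → Multigraph n → Set
Planar G = PlanarRotation G

{-# OPTIONS --safe #-}

-- An embedding is a pair of permutations of the darts, the rotation σ and the
-- flip α, with face permutation φ = σα.  Planarity of all components amounts to
-- the single equation z(σ) + z(α) + z(φ) = n + 2c, where z counts orbits, n darts
-- and c components; in general the left side is at most the right one (Ree).
-- Multiplying two of σ, α, φ by transpositions and keeping the third, so that an
-- orbit of one splits, changes the left side by 2 or 0.  It is 0 only if an orbit
-- of the other joins, and then connectivity is unchanged; so by the inequality
-- planarity survives.
--
-- From G to G′: at a vertex outside H with darts a, b, c, d in cyclic order, splice
-- the edges at a and b into one, and those at c and d.  This is a sequence of such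
-- splittings, keeps the other degrees, and leaves the edges of H alone.
--
-- From G′ to G: replace each edge outside H, in turn, by an octahedron with one
-- edge cut open, i.e. form a connected sum with the octahedron along that edge.
-- All new edges are simple, so only the edges of H remain, and H is simple.
module Submission where

open import Defs
open import Data.Bool using (Bool; true; false; if_then_else_)
open import Data.Bool.Properties using (not-involutive) renaming (_≟_ to _≟ᵇ_)
open import Data.Fin using (Fin; zero; suc; toℕ; _↑ʳ_; splitAt; join)
open import Data.Fin.Patterns using (0F; 1F; 2F; 3F; 4F; 5F; 6F; 7F)
import Data.Fin.Properties as Finₚ
open import Data.List using (List; []; _∷_; _++_; length; map; allFin; lookup; filter; cartesianProduct)
import Data.List.Properties as Listₚ
open import Data.List.Membership.Propositional using (_∈_; _∉_; lose; find)
import Data.List.Membership.Propositional.Properties as Memₚ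
open import Data.List.Relation.Unary.All as All using (All; []; _∷_)
import Data.List.Relation.Unary.All.Properties as Allₚ
open import Data.List.Relation.Unary.AllPairs as AllPairs using (AllPairs; []; _∷_)
import Data.List.Relation.Unary.AllPairs.Properties as AllPairsₚ
open import Data.List.Relation.Unary.Any as Any using (Any; here; there)
import Data.List.Relation.Unary.Any.Properties as Anyₚ
open import Data.List.Relation.Unary.Unique.Propositional using (Unique)
import Data.List.Relation.Unary.Unique.Propositional.Properties as Uniqueₚ
open import Data.Nat using (ℕ; zero; suc; _+_; _≤_; z≤n; s≤s)
open import Data.Nat.ListAction using (sum)
import Data.Nat.Properties as ℕₚ
open import Data.Nat.Tactic.RingSolver using (solve-∀)
open import Data.Product using (Σ; ∃; _×_; _,_; proj₁; proj₂)
import Data.Product.Properties as ×ₚ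
open import Data.Sum as ⊎ using (_⊎_; inj₁; inj₂; [_,_])
import Data.Sum.Properties as ⊎ₚ
open import Data.Unit using (⊤; tt)
open import Data.Vec as Vec using (Vec; []; _∷_)
open import Function using (_∘_; id; case_of_)
open import Function.Bundles using (_⇔_; mk⇔; _↣_; mk↣; Injection; mk↔ₛ′)
open import Function.Construct.Composition using (_↣-∘_)
open import Function.Properties.Inverse using (↔⇒↣)
open import Function.Definitions using (Injective)
open import Level using (0ℓ)
open import Relation.Binary using (Rel; IsEquivalence; IsDecEquivalence; DecidableEquality; Symmetric)
open import Relation.Binary.PropositionalEquality
  using (_≡_; _≢_; refl; sym; trans; cong; cong₂; subst; subst₂; isEquivalence; module ≡-Reasoning)
open import Relation.Nullary using (¬_; Dec; yes; no; contradiction; ¬?)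
open import Relation.Nullary.Decidable using (map′; _×-dec_; _⊎-dec_; _→-dec_; from-yes; decidable-stable)
open import Relation.Unary using (Decidable)

open Injection using (to; injective)

-- The defect n + 2c - z, with z the sum of the three orbit counts, is nonnegative by Ree's
-- inequality and never grows under a splitting. Once it is zero it therefore stays zero, and nobody
-- has to know whether a given splice disconnects the graph; component by component, with V + F = E
-- + 2, one would have to follow how components come apart. In the removal, a discarded dart stays
-- behind as a common fixed point of σ and α. It adds one orbit to each of σ, α, φ, one dart and one
-- component, so 3 = 1 + 2 leaves the equation intact, and neither the type of darts nor the vertex
-- set has to shrink on the way. The octahedron serves because it is planar, simple and 4-regular.
-- The two ends of its opened edge are different vertices, so the two connecting edges are not
-- parallel even if the replaced edge was a loop, and parallel edges are led to separate octahedra.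

private variable
  A B D X : Set
  n N : ℕ

-- Finite types and exhaustive search

record Finite (A : Set) : Set where
  field
    _≟_      : DecidableEquality A
    elements : List A
    complete : ∀ x → x ∈ elements

open Finite ⦃ ... ⦄

instance
  Fin-finite : ∀ {n} → Finite (Fin n)
  Fin-finite = record
    { _≟_ = Finₚ._≟_ ; elements = allFin _ ; complete = Memₚ.∈-allFin }

  Bool-finite : Finite Bool
  Bool-finite = record
    { _≟_ = _≟ᵇ_ ; elements = true ∷ false ∷ []
    ; complete = λ { true → here refl ; false → there (here refl) } }

  ×-finite : ⦃ Finite A ⦄ → ⦃ Finite B ⦄ → Finite (A × B)
  ×-finite = record
    { _≟_ = ×ₚ.≡-dec _≟_ _≟_
    ; elements = cartesianProduct elements elements
    ; complete = λ (x , y) → Memₚ.∈-cartesianProduct⁺ (complete x) (complete y) }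

  ⊎-finite : ⦃ Finite A ⦄ → ⦃ Finite B ⦄ → Finite (A ⊎ B)
  ⊎-finite = record
    { _≟_ = ⊎ₚ.≡-dec _≟_ _≟_
    ; elements = map inj₁ elements ++ map inj₂ elements
    ; complete = λ
        { (inj₁ x) → Memₚ.∈-++⁺ˡ (Memₚ.∈-map⁺ inj₁ (complete x))
        ; (inj₂ y) → Memₚ.∈-++⁺ʳ _ (Memₚ.∈-map⁺ inj₂ (complete y)) } }

any-dec : ⦃ Finite A ⦄ → {P : A → Set} → Decidable P → Dec (∃ P)
any-dec P? = map′ (λ p → let x , _ , px = find p in x , px)
  (λ (x , px) → lose (complete x) px) (Any.any? P? elements)

all-dec : ⦃ Finite A ⦄ → {P : A → Set} → Decidable P → Dec (∀ x → P x)
all-dec P? = map′ (λ ps x → All.lookup ps (complete x)) (λ p → All.universal p elements)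
  (All.all? P? elements)

-- Equivalence relations

-- For an equivalence `R`, the equivalence generated by `R` and the pair of `x` and `y`. A path
-- needs the new pair at most once, and this closed form lets decidability pass from `R`.
Merge : Rel A 0ℓ → A → A → Rel A 0ℓ
Merge R x y u v = R u v ⊎ (R u x × R y v) ⊎ (R u y × R x v)

module _ {R : Rel A 0ℓ} (R-equiv : IsEquivalence R) where
  private module R = IsEquivalence R-equiv

  merge-isEquivalence : ∀ x y → IsEquivalence (Merge R x y)
  merge-isEquivalence x y = record { refl = inj₁ R.refl ; sym = merge-sym ; trans = merge-trans }
    where
    merge-sym : Symmetric (Merge R x y)
    merge-sym (inj₁ uv) = inj₁ (R.sym uv)
    merge-sym (inj₂ (inj₁ (ux , yv))) = inj₂ (inj₂ (R.sym yv , R.sym ux))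
    merge-sym (inj₂ (inj₂ (uy , xv))) = inj₂ (inj₁ (R.sym xv , R.sym uy))

    merge-trans : ∀ {u v w} → Merge R x y u v → Merge R x y v w → Merge R x y u w
    merge-trans (inj₁ uv) (inj₁ vw) = inj₁ (R.trans uv vw)
    merge-trans (inj₁ uv) (inj₂ (inj₁ (vx , yw))) = inj₂ (inj₁ (R.trans uv vx , yw))
    merge-trans (inj₁ uv) (inj₂ (inj₂ (vy , xw))) = inj₂ (inj₂ (R.trans uv vy , xw))
    merge-trans (inj₂ (inj₁ (ux , yv))) (inj₁ vw) = inj₂ (inj₁ (ux , R.trans yv vw))
    merge-trans (inj₂ (inj₂ (uy , xv))) (inj₁ vw) = inj₂ (inj₂ (uy , R.trans xv vw))
    merge-trans (inj₂ (inj₁ (ux , yv))) (inj₂ (inj₁ (vx , yw))) = inj₂ (inj₁ (ux , yw))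
    merge-trans (inj₂ (inj₁ (ux , yv))) (inj₂ (inj₂ (vy , xw))) = inj₁ (R.trans ux xw)
    merge-trans (inj₂ (inj₂ (uy , xv))) (inj₂ (inj₁ (vx , yw))) = inj₁ (R.trans uy yw)
    merge-trans (inj₂ (inj₂ (uy , xv))) (inj₂ (inj₂ (vy , xw))) = inj₂ (inj₂ (uy , xw))

  merge-fold : ∀ {S : Rel A 0ℓ} → IsEquivalence S → (∀ {u v} → R u v → S u v) →
    ∀ {x y} → S x y → ∀ {u v} → Merge R x y u v → S u v
  merge-fold S-equiv R⊆S xy = λ
    { (inj₁ uv) → R⊆S uv
    ; (inj₂ (inj₁ (ux , yv))) → S.trans (R⊆S ux) (S.trans xy (R⊆S yv))
    ; (inj₂ (inj₂ (uy , xv))) → S.trans (R⊆S uy) (S.trans (S.sym xy) (R⊆S xv)) }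
    where module S = IsEquivalence S-equiv

merge-isDecEquivalence : ∀ {R : Rel A 0ℓ} → IsDecEquivalence R →
  ∀ x y → IsDecEquivalence (Merge R x y)
merge-isDecEquivalence dec x y = record
  { isEquivalence = merge-isEquivalence isEquiv x y
  ; _≟_ = λ u v → R? u v ⊎-dec (R? u x ×-dec R? y v) ⊎-dec (R? u y ×-dec R? x v) }
  where open IsDecEquivalence dec renaming (isEquivalence to isEquiv; _≟_ to R?)

≡-isDecEquivalence : ⦃ Finite A ⦄ → IsDecEquivalence {A = A} _≡_
≡-isDecEquivalence = record { isEquivalence = isEquivalence ; _≟_ = _≟_ }

isDecEquivalence-resp : ∀ {R S : Rel A 0ℓ} → (∀ {x y} → R x y → S x y) →
  (∀ {x y} → S x y → R x y) → IsEquivalence S → IsDecEquivalence R → IsDecEquivalence S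
isDecEquivalence-resp R⊆S S⊆R S-equiv dec = record
  { isEquivalence = S-equiv
  ; _≟_ = λ x y → map′ R⊆S S⊆R (IsDecEquivalence._≟_ dec x y) }

-- Reach and Conn are shown decidable by comparison with this closure.
Generated : List (A × A) → Rel A 0ℓ
Generated [] = _≡_
Generated ((x , y) ∷ ps) = Merge (Generated ps) x y

generated-isDecEquivalence : ⦃ Finite A ⦄ → ∀ ps → IsDecEquivalence {A = A} (Generated ps)
generated-isDecEquivalence [] = ≡-isDecEquivalence
generated-isDecEquivalence ((x , y) ∷ ps) = merge-isDecEquivalence (generated-isDecEquivalence ps) x y

generated-∈ : ⦃ _ : Finite A ⦄ → ∀ ps {x y : A} → (x , y) ∈ ps → Generated ps x y
generated-∈ (_ ∷ ps) (here refl) = inj₂ (inj₁ (G.refl , G.refl))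
  where module G = IsDecEquivalence (generated-isDecEquivalence ps)
generated-∈ (_ ∷ ps) (there p) = inj₁ (generated-∈ ps p)

generated-fold : ⦃ _ : Finite A ⦄ → {S : Rel A 0ℓ} → IsEquivalence S → ∀ ps →
  All (λ (x , y) → S x y) ps → ∀ {u v} → Generated ps u v → S u v
generated-fold S-equiv [] [] refl = IsEquivalence.refl S-equiv
generated-fold S-equiv (p ∷ ps) (xy ∷ rest) =
  merge-fold (IsDecEquivalence.isEquivalence (generated-isDecEquivalence ps)) S-equiv
    (generated-fold S-equiv ps rest) xy

-- Counting equivalence classes

module _ {R : Rel A 0ℓ} (R-equiv : IsEquivalence R) where
  private module R = IsEquivalence R-equiv

  -- Independence of `L` enters only through `separates`, so a list that merely covers can be
  -- thinned out in the same way.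
  record RepresentativeRemoved (L : List A) (y : A) : Set where
    field
      rest      : List A
      size      : length L ≡ suc (length rest)
      restricts : ∀ {z} → z ∈ rest → z ∈ L
      separates : AllPairs (λ a b → ¬ R a b) L → AllPairs (λ a b → ¬ R a b) rest × All (λ r → ¬ R y r) rest
      covers    : ∀ {z} → Any (λ r → R r z) L → R y z ⊎ Any (λ r → R r z) rest

  removeRepresentative : ∀ L {y} → Any (λ r → R r y) L → RepresentativeRemoved L y
  removeRepresentative (r ∷ L) (here ry) = record
    { rest = L ; size = refl ; restricts = there
    ; separates = λ { (r∉ ∷ ap) → ap , All.map (λ ¬rs ys → ¬rs (R.trans ry ys)) r∉ }
    ; covers = λ { (here rz) → inj₁ (R.trans (R.sym ry) rz) ; (there p) → inj₂ p } }
  removeRepresentative (r ∷ L) (there p) = record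
    { rest = r ∷ rest ; size = cong suc size
    ; restricts = λ { (here eq) → here eq ; (there q) → there (restricts q) }
    ; separates = λ { (r∉ ∷ ap) →
        let ap′ , y∉ = separates ap
            ¬rs , sy = All.lookupAny r∉ p
        in Allₚ.anti-mono restricts r∉ ∷ ap′ , (λ yr → ¬rs (R.sym (R.trans sy yr))) ∷ y∉ }
    ; covers = λ { (here rz) → inj₂ (here rz) ; (there q) → ⊎.map₂ there (covers q) } }
    where
    open RepresentativeRemoved (removeRepresentative L p)

  open RepresentativeRemoved

  -- Each element of `L₁` uses up one representative in `L₂`. The later elements are unrelated to
  -- it, hence still covered by what is left.
  independent≤covering : ∀ {L₁ L₂} → AllPairs (λ a b → ¬ R a b) L₁ →
    All (λ x → Any (λ r → R r x) L₂) L₁ → length L₁ ≤ length L₂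
  independent≤covering [] [] = z≤n
  independent≤covering {_ ∷ _} {L₂} (r∉ ∷ ap) (c ∷ cs) =
    let rem = removeRepresentative L₂ c in
    subst (_ ≤_) (sym (size rem))
      (s≤s (independent≤covering ap (All.zipWith (λ (¬rz , cz) → [ (λ rz → contradiction rz ¬rz) , id ] (covers rem cz)) (r∉ , cs))))

  numClasses-unique : ∀ {P j k} → NumClasses R P j → NumClasses R P k → j ≡ k
  numClasses-unique (L , refl , inP , ap , cover) (L′ , refl , inP′ , ap′ , cover′) =
    ℕₚ.≤-antisym (independent≤covering ap (All.map (cover′ _) inP))
                 (independent≤covering ap′ (All.map (cover _) inP′))

  -- The representative of the class of `y` is dropped. The one of the class of `x` survives,
  -- because the two classes differ, and now covers both.
  numClasses-merge : ∀ {P k x y} → P x → P y → ¬ R x y → NumClasses R P k →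
    ∃ λ j → k ≡ suc j × NumClasses (Merge R x y) P j
  numClasses-merge {P} {k} {x} {y} px py ¬xy (L , refl , inP , ap , cover) =
    length (rest rem) , size rem , rest rem , refl , Allₚ.anti-mono (restricts rem) inP ,
    independent (proj₁ (separates rem ap)) (proj₂ (separates rem ap)) , covering
    where
    rem = removeRepresentative L (cover y py)

    independent : ∀ {K} → AllPairs (λ a b → ¬ R a b) K → All (λ r → ¬ R y r) K →
      AllPairs (λ a b → ¬ Merge R x y a b) K
    independent [] [] = []
    independent (r∉ ∷ aps) (¬yr ∷ ¬ys) =
      All.zipWith (λ { (¬ab , ¬yb) (inj₁ ab) → ¬ab ab
                     ; (¬ab , ¬yb) (inj₂ (inj₁ (ax , yb))) → ¬yb yb
                     ; (¬ab , ¬yb) (inj₂ (inj₂ (ay , xb))) → ¬yr (R.sym ay) }) (r∉ , ¬ys)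
      ∷ independent aps ¬ys

    covering : ∀ z → P z → Any (λ r → Merge R x y r z) (rest rem)
    covering z pz with covers rem (cover z pz)
    ... | inj₂ p = Any.map inj₁ p
    ... | inj₁ yz with covers rem (cover x px)
    ...   | inj₂ p = Any.map (λ rx → inj₂ (inj₁ (rx , yz))) p
    ...   | inj₁ yx = contradiction (R.sym yx) ¬xy

numClasses-resp : ∀ {R S : Rel A 0ℓ} {P : A → Set} {k} →
  (∀ {x y} → P x → P y → R x y → S x y) → (∀ {x y} → P x → P y → S x y → R x y) →
  NumClasses R P k → NumClasses S P k
numClasses-resp {R = R} {S} {P} R⊆S S⊆R (L , eq , inP , ap , cover) =
  L , eq , inP , separate inP ap ,
  λ z pz → relate inP pz (cover z pz)
  where
  separate : ∀ {L} → All P L → AllPairs (λ a b → ¬ R a b) L → AllPairs (λ a b → ¬ S a b) L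
  separate [] [] = []
  separate (p ∷ ps) (r∉ ∷ ap) =
    All.zipWith (λ (q , ¬r) s → ¬r (S⊆R p q s)) (ps , r∉) ∷ separate ps ap

  relate : ∀ {L z} → All P L → P z → Any (λ r → R r z) L → Any (λ r → S r z) L
  relate (p ∷ ps) pz (here r) = here (R⊆S p pz r)
  relate (p ∷ ps) pz (there q) = there (relate ps pz q)

numClasses-pred : ∀ {R : Rel A 0ℓ} {P Q : A → Set} {k} →
  (∀ {x} → P x → Q x) → (∀ {x} → Q x → P x) → NumClasses R P k → NumClasses R Q k
numClasses-pred P⊆Q Q⊆P (L , eq , inP , ap , cover) =
  L , eq , All.map P⊆Q inP , ap , λ x qx → cover x (Q⊆P qx)

numClasses-∪ : ∀ {R : Rel A 0ℓ} {P Q : A → Set} {j k} →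
  (∀ {x y} → P x → Q y → ¬ R x y) → NumClasses R P j → NumClasses R Q k →
  NumClasses R (λ x → P x ⊎ Q x) (j + k)
numClasses-∪ sep (L , refl , inP , ap , cover) (L′ , refl , inQ , ap′ , cover′) =
  L ++ L′ , Listₚ.length-++ L ,
  Allₚ.++⁺ (All.map inj₁ inP) (All.map inj₂ inQ) ,
  AllPairsₚ.++⁺ ap ap′ (All.map (λ p → All.map (sep p) inQ) inP) ,
  λ { x (inj₁ p) → Anyₚ.++⁺ˡ (cover x p) ; x (inj₂ q) → Anyₚ.++⁺ʳ L (cover′ x q) }

-- Classes of R on A correspond to those of S on B as soon as s : B → A picks
-- representatives and π : A → B sends an element to one equivalent to it.
numClasses-retract : ∀ {R : Rel A 0ℓ} {S : Rel B 0ℓ} {P : A → Set} {Q : B → Set} {k} →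
  IsEquivalence R → (π : A → B) (s : B → A) →
  (∀ {x} → P x → Q (π x)) → (∀ {y} → Q y → P (s y)) →
  (∀ {y y′} → R (s y) (s y′) → S y y′) → (∀ {y y′} → S y y′ → R (s y) (s y′)) →
  (∀ {x} → P x → R (s (π x)) x) → NumClasses S Q k → NumClasses R P k
numClasses-retract R-equiv π s πP sQ reflect preserve sπ (L , refl , inQ , ap , cover) =
  map s L , Listₚ.length-map s L , Allₚ.map⁺ (All.map sQ inQ) ,
  AllPairsₚ.map⁺ (AllPairs.map (λ ¬S r → ¬S (reflect r)) ap) ,
  λ x px → Anyₚ.map⁺ (Any.map (λ q → IsEquivalence.trans R-equiv (preserve q) (sπ px)) (cover (π x) (πP px)))

abstract
  -- The representatives are chosen greedily. The choice is opaque: only its specification is used,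
  -- and `numClasses-unique` makes the number independent of it.
  numClasses-exists : ⦃ Finite A ⦄ → {R : Rel A 0ℓ} → IsDecEquivalence R →
    {P : A → Set} → Decidable P → ∃ (NumClasses R P)
  numClasses-exists {R = R} dec {P} P? =
    let L , inP , ap , cover = greedy elements
    in length L , L , refl , inP , ap , λ x → cover (complete x)
    where
    open IsDecEquivalence dec using () renaming (_≟_ to R?; sym to R-sym; refl to R-refl)
    greedy : ∀ K → ∃ λ L → All P L × AllPairs (λ a b → ¬ R a b) L ×
      (∀ {x} → x ∈ K → P x → Any (λ r → R r x) L)
    greedy [] = [] , [] , [] , λ ()
    greedy (x ∷ K) with greedy K
    ... | L , inP , ap , cover with P? x | Any.any? (λ r → R? r x) L
    ...   | no ¬px | _ = L , inP , ap , λ { (here refl) px → contradiction px ¬px ; (there p) → cover p }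
    ...   | yes px | yes old = L , inP , ap , λ { (here refl) _ → old ; (there p) → cover p }
    ...   | yes px | no new = x ∷ L , px ∷ inP ,
              All.map (λ ¬rx xr → ¬rx (R-sym xr)) (Allₚ.¬Any⇒All¬ L new) ∷ ap ,
              λ { (here refl) _ → here R-refl ; (there p) py → there (cover p py) }

-- Orbits

-- An injection of a finite set stands for a permutation throughout.

iter-+ : ∀ (f : D → D) j k x → iter f (j + k) x ≡ iter f j (iter f k x)
iter-+ f zero k x = refl
iter-+ f (suc j) k x = cong f (iter-+ f j k x)

iter-shift : ∀ (f : D → D) k x → iter f k (f x) ≡ f (iter f k x)
iter-shift f zero x = refl
iter-shift f (suc k) x = cong f (iter-shift f k x)

iter-injective : ∀ (f : D ↣ D) k {x y} → iter (to f) k x ≡ iter (to f) k y → x ≡ y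
iter-injective f zero eq = eq
iter-injective f (suc k) eq = iter-injective f k (injective f eq)

reach-refl : ∀ {f : D → D} {x} → Reach f x x
reach-refl = 0 , refl

reach-step : ∀ (f : D → D) x → Reach f x (f x)
reach-step f x = 1 , refl

reach-trans : ∀ {f : D → D} {x y z} → Reach f x y → Reach f y z → Reach f x z
reach-trans {f = f} (j , refl) (k , refl) = k + j , iter-+ f k j _

reach-fold : ∀ {f : D → D} {S : Rel D 0ℓ} → IsEquivalence S → (∀ x → S x (f x)) →
  ∀ {x y} → Reach f x y → S x y
reach-fold S-equiv step (zero , refl) = IsEquivalence.refl S-equiv
reach-fold S-equiv step (suc k , refl) =
  IsEquivalence.trans S-equiv (reach-fold S-equiv step (k , refl)) (step _)

reach-cong : ∀ {f g : D → D} → (∀ x → f x ≡ g x) → ∀ {x y} → Reach f x y → Reach g x y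
reach-cong {f = f} {g} eq {x} (k , refl) = k , sym (go k)
  where
  go : ∀ k → iter f k x ≡ iter g k x
  go zero = refl
  go (suc k) = trans (eq _) (cong g (go k))

reach-closed : ∀ {f : D → D} {P : D → Set} → (∀ {x} → P x → P (f x)) →
  ∀ {x y} → P x → Reach f x y → P y
reach-closed step px (zero , refl) = px
reach-closed {P = P} step px (suc k , refl) = step (reach-closed {P = P} step px (k , refl))

reach-mapOn : ∀ {E : Set} {f : D → D} {g : E → E} (h : D → E) (P : D → Set) →
  (∀ {x} → P x → P (f x)) → (∀ {x} → P x → h (f x) ≡ g (h x)) →
  ∀ {x y} → P x → Reach f x y → Reach g (h x) (h y)
reach-mapOn h P step comm px (zero , refl) = 0 , refl
reach-mapOn {g = g} h P step comm {x} px (suc k , refl) =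
  let k′ , eq = reach-mapOn {g = g} h P step comm px (k , refl)
  in suc k′ , trans (cong g eq) (sym (comm (reach-closed {P = P} step px (k , refl))))

conn-fold : ∀ {σ α : D → D} {S : Rel D 0ℓ} → IsEquivalence S →
  (∀ x → S x (σ x)) → (∀ x → S x (α x)) → ∀ {x y} → Conn σ α x y → S x y
conn-fold S-equiv sσ sα here = IsEquivalence.refl S-equiv
conn-fold S-equiv sσ sα (stepσ c) = IsEquivalence.trans S-equiv (conn-fold S-equiv sσ sα c) (sσ _)
conn-fold S-equiv sσ sα (stepα c) = IsEquivalence.trans S-equiv (conn-fold S-equiv sσ sα c) (sα _)

conn-closed : ∀ {σ α : D → D} {P : D → Set} → (∀ {x} → P x → P (σ x)) → (∀ {x} → P x → P (α x)) →
  ∀ {x y} → P x → Conn σ α x y → P y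
conn-closed cσ cα px here = px
conn-closed cσ cα px (stepσ c) = cσ (conn-closed cσ cα px c)
conn-closed cσ cα px (stepα c) = cα (conn-closed cσ cα px c)

conn-trans : ∀ {σ α : D → D} {x y z} → Conn σ α x y → Conn σ α y z → Conn σ α x z
conn-trans c here = c
conn-trans c (stepσ d) = stepσ (conn-trans c d)
conn-trans c (stepα d) = stepα (conn-trans c d)

reach⇒connσ : ∀ {σ α : D → D} {x y} → Reach σ x y → Conn σ α x y
reach⇒connσ (zero , refl) = here
reach⇒connσ (suc k , refl) = stepσ (reach⇒connσ (k , refl))

reach⇒connα : ∀ {σ α : D → D} {x y} → Reach α x y → Conn σ α x y
reach⇒connα (zero , refl) = here
reach⇒connα (suc k , refl) = stepα (reach⇒connα (k , refl))

reach⇒connφ : ∀ {σ α : D → D} {x y} → Reach (λ d → σ (α d)) x y → Conn σ α x y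
reach⇒connφ (zero , refl) = here
reach⇒connφ (suc k , refl) = stepσ (stepα (reach⇒connφ (k , refl)))

module _ ⦃ fin : Finite D ⦄ where

  private
    index-injective : ∀ {L : List D} {x y} (p : x ∈ L) (q : y ∈ L) → Any.index p ≡ Any.index q → x ≡ y
    index-injective (here refl) (here refl) _ = refl
    index-injective (there p) (there q) eq = index-injective p q (Finₚ.suc-injective eq)

  -- Among more iterates than `elements` has entries, two share an index and so coincide;
  -- injectivity cancels the iterates common to both.
  period : ∀ (f : D ↣ D) x → ∃ λ k → iter (to f) (suc k) x ≡ x
  period f x with Finₚ.pigeonhole (ℕₚ.n<1+n (length (Finite.elements fin)))
                    (λ i → Any.index (Finite.complete fin (iter (to f) (toℕ i) x)))
  ... | i , j , i<j , eq with ℕₚ.m≤n⇒∃[o]m+o≡n i<j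
  ... | o , i+o≡j = o , iter-injective f (toℕ i) (begin
    iter (to f) (toℕ i) (iter (to f) (suc o) x) ≡⟨ iter-+ (to f) (toℕ i) (suc o) x ⟨
    iter (to f) (toℕ i + suc o) x ≡⟨ cong (λ k → iter (to f) k x) (trans (ℕₚ.+-suc (toℕ i) o) i+o≡j) ⟩
    iter (to f) (toℕ j) x ≡⟨ index-injective (complete _) (complete _) eq ⟨
    iter (to f) (toℕ i) x ∎)
    where open ≡-Reasoning

  inverse : (D ↣ D) → D → D
  inverse f x = iter (to f) (proj₁ (period f x)) x

  inverseʳ : ∀ (f : D ↣ D) x → to f (inverse f x) ≡ x
  inverseʳ f x = proj₂ (period f x)

  reach-sym : ∀ (f : D ↣ D) {x y} → Reach (to f) x y → Reach (to f) y x
  reach-sym f (zero , refl) = 0 , refl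
  reach-sym f {x} (suc k , refl) = reach-trans back (reach-sym f (k , refl))
    where
    z = iter (to f) k x
    back : Reach (to f) (to f z) z
    back = proj₁ (period f z) , trans (iter-shift (to f) (proj₁ (period f z)) z) (proj₂ (period f z))

  reach-isEquivalence : ∀ (f : D ↣ D) → IsEquivalence (Reach (to f))
  reach-isEquivalence f = record { refl = reach-refl ; sym = reach-sym f ; trans = reach-trans }

  private
    graph : (D → D) → List (D × D)
    graph f = map (λ x → x , f x) elements

    graph-∈ : ∀ f x → (x , f x) ∈ graph f
    graph-∈ f x = Memₚ.∈-map⁺ _ (complete x)

    graph-All : ∀ f {S : Rel D 0ℓ} → (∀ x → S x (f x)) → All (λ (x , y) → S x y) (graph f)
    graph-All f step = Allₚ.map⁺ (All.universal step elements)

  abstract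
    reach-isDecEquivalence : ∀ (f : D ↣ D) → IsDecEquivalence (Reach (to f))
    reach-isDecEquivalence f = isDecEquivalence-resp
      (generated-fold equiv (graph (to f)) (graph-All (to f) (reach-step (to f))))
      (reach-fold G.isEquivalence (λ x → generated-∈ _ (graph-∈ (to f) x)))
      equiv (generated-isDecEquivalence (graph (to f)))
      where
      equiv : IsEquivalence (Reach (to f))
      equiv = reach-isEquivalence f
      module G = IsDecEquivalence (generated-isDecEquivalence (graph (to f)))

  conn-sym : ∀ (σ α : D ↣ D) {x y} → Conn (to σ) (to α) x y → Conn (to σ) (to α) y x
  conn-sym σ α here = here
  conn-sym σ α (stepσ c) = conn-trans (reach⇒connσ (reach-sym σ (reach-step (to σ) _))) (conn-sym σ α c)
  conn-sym σ α (stepα c) = conn-trans (reach⇒connα (reach-sym α (reach-step (to α) _))) (conn-sym σ α c)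

  conn-isEquivalence : ∀ (σ α : D ↣ D) → IsEquivalence (Conn (to σ) (to α))
  conn-isEquivalence σ α = record { refl = here ; sym = conn-sym σ α ; trans = conn-trans }

  abstract
    conn-isDecEquivalence : ∀ (σ α : D ↣ D) → IsDecEquivalence (Conn (to σ) (to α))
    conn-isDecEquivalence σ α = isDecEquivalence-resp
      (generated-fold equiv pairs (Allₚ.++⁺ (graph-All (to σ) (λ _ → stepσ here)) (graph-All (to α) (λ _ → stepα here))))
      (conn-fold G.isEquivalence
        (λ x → generated-∈ pairs (Memₚ.∈-++⁺ˡ (graph-∈ (to σ) x)))
        (λ x → generated-∈ pairs (Memₚ.∈-++⁺ʳ (graph (to σ)) (graph-∈ (to α) x))))
      equiv (generated-isDecEquivalence pairs)
      where
      equiv : IsEquivalence (Conn (to σ) (to α))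
      equiv = conn-isEquivalence σ α
      pairs : List (D × D)
      pairs = graph (to σ) ++ graph (to α)
      module G = IsDecEquivalence (generated-isDecEquivalence pairs)

-- Transpositions

module _ ⦃ fin : Finite D ⦄ where

  abstract
    transpose : D → D → D → D
    transpose x y d with d ≟ x | d ≟ y
    ... | yes _ | _     = y
    ... | no _  | yes _ = x
    ... | no _  | no _  = d

    transpose-left : ∀ (x y : D) → transpose x y x ≡ y
    transpose-left x y with x ≟ x
    ... | yes _ = refl
    ... | no x≢x = contradiction refl x≢x

    transpose-right : ∀ (x y : D) → transpose x y y ≡ x
    transpose-right x y with y ≟ x | y ≟ y
    ... | yes y≡x | _ = y≡x
    ... | no _ | yes _ = refl
    ... | no _ | no y≢y = contradiction refl y≢y

    transpose-fix : ∀ {x y d : D} → d ≢ x → d ≢ y → transpose x y d ≡ d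
    transpose-fix {x} {y} {d} d≢x d≢y with d ≟ x | d ≟ y
    ... | yes d≡x | _ = contradiction d≡x d≢x
    ... | no _ | yes d≡y = contradiction d≡y d≢y
    ... | no _ | no _ = refl

    -- Since `transpose` is opaque, goals are phrased as a relation between a dart and its image and
    -- split here into the three cases.
    transpose-elim : ∀ {x y : D} (Q : D → D → Set) → Q x y → Q y x → (∀ {d} → d ≢ x → d ≢ y → Q d d) →
      ∀ d → Q d (transpose x y d)
    transpose-elim {x} {y} Q qx qy qd d with d ≟ x | d ≟ y
    ... | yes refl | _ = qx
    ... | no _ | yes refl = qy
    ... | no d≢x | no d≢y = qd d≢x d≢y

  transpose-involutive : ∀ (x y d : D) → transpose x y (transpose x y d) ≡ d
  transpose-involutive x y = transpose-elim (λ d e → transpose x y e ≡ d)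
    (transpose-right x y) (transpose-left x y) transpose-fix

  transpose-id : ∀ (x d : D) → transpose x x d ≡ d
  transpose-id x = transpose-elim (λ d e → e ≡ d) refl refl (λ _ _ → refl)

  transposition : D → D → D ↣ D
  transposition x y = mk↣ λ {d} {e} eq → trans (sym (transpose-involutive x y d))
    (trans (cong (transpose x y) eq) (transpose-involutive x y e))

  transpose-conjugate : ∀ (f : D ↣ D) u v d → transpose (to f u) (to f v) (to f d) ≡ to f (transpose u v d)
  transpose-conjugate f u v = transpose-elim (λ d e → transpose (to f u) (to f v) (to f d) ≡ to f e)
    (transpose-left _ _) (transpose-right _ _)
    (λ d≢u d≢v → transpose-fix (d≢u ∘ injective f) (d≢v ∘ injective f))

-- Multiplying by a transposition splits or joins orbits

module _ ⦃ fin : Finite D ⦄ (f : D ↣ D) {x y : D} (x≢y : x ≢ y) where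
  private
    g : D → D
    g d = to f (transpose x y d)

    g-x : g x ≡ to f y
    g-x = cong (to f) (transpose-left x y)

    g-fix : ∀ {d} → d ≢ x → d ≢ y → g d ≡ to f d
    g-fix d≢x d≢y = cong (to f) (transpose-fix d≢x d≢y)

  -- From `x`, the map `g` continues at `f y` and then follows `f` around the orbit of `y`. That
  -- orbit misses `x`, so nothing diverts it before it arrives at `y`, at the latest after a full
  -- period.
  orbits-join : ¬ Reach (to f) x y → Reach g x y
  orbits-join ¬xy = [ id , (λ eq → suc p , trans eq (proj₂ (period f y))) ] (follow p)
    where
    p = proj₁ (period f y)
    follow : ∀ k → Reach g x y ⊎ iter g (suc k) x ≡ iter (to f) (suc k) y
    follow zero = inj₂ g-x
    follow (suc k) with follow k
    ... | inj₁ r = inj₁ r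
    ... | inj₂ eq with iter (to f) (suc k) y ≟ y
    ...   | yes back = inj₁ (suc k , trans eq back)
    ...   | no z≢y = inj₂ (trans (cong g eq)
              (g-fix (λ z≡x → ¬xy (reach-sym f (suc k , z≡x))) z≢y))

  private
    -- The invariant that separates `x` from `y` after the split: the points from which `f` runs to
    -- `x` without meeting `y`.
    data ReachesAvoiding : D → Set where
      done : ReachesAvoiding x
      step : ∀ {z} → z ≢ y → ReachesAvoiding (to f z) → ReachesAvoiding z

    ¬avoiding-y : ¬ ReachesAvoiding y
    ¬avoiding-y = go refl
      where
      go : ∀ {z} → z ≡ y → ¬ ReachesAvoiding z
      go z≡y done = x≢y z≡y
      go z≡y (step z≢y _) = z≢y z≡y

    lastVisit : ∀ k z → iter (to f) k z ≡ x → ReachesAvoiding z ⊎ ReachesAvoiding (to f y)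
    lastVisit zero z refl = inj₁ done
    lastVisit (suc k) z eq with lastVisit k (to f z) (trans (iter-shift (to f) k z) eq)
    ... | inj₂ a = inj₂ a
    ... | inj₁ a with z ≟ y
    ...   | yes refl = inj₂ a
    ...   | no z≢y = inj₁ (step z≢y a)

  -- The invariant holds at `x`, fails at `y` and is kept by `g`. Away from `x` and `y`, `g` follows
  -- `f`; at `x` it continues at `f y`, from where the `f`-path from `y` to `x`, cut after its last
  -- visit to `y`, leads on.
  orbits-split : Reach (to f) x y → ¬ Reach g x y
  orbits-split xy r = ¬avoiding-y (reach-closed {P = ReachesAvoiding} closed done r)
    where
    fy : ReachesAvoiding (to f y)
    fy = let k , eq = reach-sym f xy in [ (λ a → contradiction a ¬avoiding-y) , id ] (lastVisit k y eq)
    closed : ∀ {z} → ReachesAvoiding z → ReachesAvoiding (g z)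
    closed {z} a = cases (z ≟ x) a
      where
      cases : ∀ {z} → Dec (z ≡ x) → ReachesAvoiding z → ReachesAvoiding (g z)
      cases (yes refl) _ = subst ReachesAvoiding (sym g-x) fy
      cases (no z≢x) done = contradiction refl z≢x
      cases (no z≢x) (step z≢y b) = subst ReachesAvoiding (sym (g-fix z≢x z≢y)) b

-- Euler characteristic

-- Here `s` is the sum of the three orbit counts and `c` the number of components. In both
-- alternatives the defect n + 2c - s does not increase, so its nonnegativity passes backwards from
-- the split pair, and its vanishing passes forwards as soon as the new defect is known to be
-- nonnegative.
SplitStep : (s c s′ c′ : ℕ) → Set
SplitStep s c s′ c′ = (s′ ≡ 2 + s × c′ ≤ suc c) ⊎ (s′ ≡ s × c′ ≡ c)

splitStep-≤ : ∀ {n s c s′ c′} → SplitStep s c s′ c′ → s′ ≤ n + (c′ + c′) → s ≤ n + (c + c)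
splitStep-≤ {n} {s} {c} {s′} {c′} (inj₁ (refl , c′≤)) le = ℕₚ.+-cancelˡ-≤ 2 _ _ (begin
  2 + s                 ≤⟨ le ⟩
  n + (c′ + c′)         ≤⟨ ℕₚ.+-monoʳ-≤ n (ℕₚ.+-mono-≤ c′≤ c′≤) ⟩
  n + (suc c + suc c)   ≡⟨ shift n c ⟩
  2 + (n + (c + c))     ∎)
  where
  open ℕₚ.≤-Reasoning
  shift : ∀ n c → n + (suc c + suc c) ≡ 2 + (n + (c + c))
  shift = solve-∀
splitStep-≤ (inj₂ (refl , refl)) le = le

splitStep-≡ : ∀ {n s c s′ c′} → SplitStep s c s′ c′ → s ≡ n + (c + c) →
  s′ ≤ n + (c′ + c′) → s′ ≡ n + (c′ + c′)
splitStep-≡ {n} {s} {c} {s′} {c′} (inj₁ (refl , c′≤)) eq le = ℕₚ.≤-antisym le (begin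
  n + (c′ + c′)         ≤⟨ ℕₚ.+-monoʳ-≤ n (ℕₚ.+-mono-≤ c′≤ c′≤) ⟩
  n + (suc c + suc c)   ≡⟨ shift n c ⟩
  2 + (n + (c + c))     ≡⟨ cong (2 +_) eq ⟨
  2 + s                 ∎)
  where
  open ℕₚ.≤-Reasoning
  shift : ∀ n c → n + (suc c + suc c) ≡ 2 + (n + (c + c))
  shift = solve-∀
splitStep-≡ (inj₂ (refl , refl)) eq le = eq

-- All counts are restricted to a set `P`: it is everything for the global equation, and a component
-- or the complement of one when the local equation is extracted.
module Euler ⦃ fin : Finite D ⦄ {P : D → Set} (P? : Decidable P) where

  abstract
    # : ∀ {R : Rel D 0ℓ} → IsDecEquivalence R → ℕ
    # dec = proj₁ (numClasses-exists dec P?)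

    #-spec : ∀ {R : Rel D 0ℓ} (dec : IsDecEquivalence R) → NumClasses R P (# dec)
    #-spec dec = proj₂ (numClasses-exists dec P?)

  #-cong : ∀ {R S : Rel D 0ℓ} (decR : IsDecEquivalence R) (decS : IsDecEquivalence S) →
    (∀ {x y} → P x → P y → R x y → S x y) → (∀ {x y} → P x → P y → S x y → R x y) → # decR ≡ # decS
  #-cong decR decS R⊆S S⊆R = numClasses-unique (IsDecEquivalence.isEquivalence decS)
    (numClasses-resp R⊆S S⊆R (#-spec decR)) (#-spec decS)

  #-merge : ∀ {R S : Rel D 0ℓ} (decR : IsDecEquivalence R) (decS : IsDecEquivalence S) {x y} →
    P x → P y → ¬ R x y → (∀ {u v} → Merge R x y u v → S u v) → (∀ {u v} → S u v → Merge R x y u v) →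
    # decR ≡ suc (# decS)
  #-merge decR decS px py ¬xy to-S from-S =
    let j , eq , nc = numClasses-merge (IsDecEquivalence.isEquivalence decR) px py ¬xy (#-spec decR)
    in trans eq (cong suc (numClasses-unique (IsDecEquivalence.isEquivalence decS)
         (numClasses-resp (λ _ _ → to-S) (λ _ _ → from-S) nc) (#-spec decS)))

  orbits : (D ↣ D) → ℕ
  orbits f = # (reach-isDecEquivalence f)

  components : (D ↣ D) → (D ↣ D) → ℕ
  components σ α = # (conn-isDecEquivalence σ α)

  size : ℕ
  size = # ≡-isDecEquivalence

  orbits-cong : ∀ f g → (∀ d → to f d ≡ to g d) → orbits f ≡ orbits g
  orbits-cong f g eq = #-cong _ _ (λ _ _ → reach-cong eq) (λ _ _ → reach-cong (λ d → sym (eq d)))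

  module _ (f g : D ↣ D) {x y : D} (x≢y : x ≢ y) (px : P x) (py : P y)
           (g≡ : ∀ d → to g d ≡ to f (transpose x y d)) where

    -- The orbit relation of `g` is that of `f` with the classes of `x` and `y` merged: single steps
    -- of each permutation are followed in the other, with `orbits-join` bridging `x` and `y`.
    orbits-joined : ¬ Reach (to f) x y → orbits f ≡ suc (orbits g)
    orbits-joined ¬xy = #-merge (reach-isDecEquivalence f) (reach-isDecEquivalence g) px py ¬xy
      (merge-fold F G (reach-fold G f-step) xy)
      (reach-fold (merge-isEquivalence F x y) g-step)
      where
      F = reach-isEquivalence f
      G = reach-isEquivalence g
      xy : Reach (to g) x y
      xy = reach-cong (λ d → sym (g≡ d)) (orbits-join f x≢y ¬xy)

      f-step : ∀ d → Reach (to g) d (to f d)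
      f-step d = subst (Reach (to g) d) (trans (g≡ _) (cong (to f) (transpose-involutive x y d)))
        (reach-trans (transpose-elim (Reach (to g)) xy (reach-sym g xy) (λ _ _ → reach-refl) d)
                     (reach-step (to g) _))

      g-step : ∀ d → Merge (Reach (to f)) x y d (to g d)
      g-step d = subst (Merge (Reach (to f)) x y d) (sym (g≡ d))
        (transpose-elim (λ d e → Merge (Reach (to f)) x y d (to f e))
          (inj₂ (inj₁ (reach-refl , reach-step _ _))) (inj₂ (inj₂ (reach-refl , reach-step _ _)))
          (λ _ _ → inj₁ (reach-step _ _)) d)

  -- A splitting is a joining read backwards: multiplying `g` by the same transposition gives `f`
  -- again.
  orbits-divided : ∀ (f g : D ↣ D) {x y : D} → x ≢ y → P x → P y →
    (∀ d → to g d ≡ to f (transpose x y d)) → Reach (to f) x y → orbits g ≡ suc (orbits f)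
  orbits-divided f g {x} {y} x≢y px py g≡ xy = orbits-joined g f x≢y px py
    (λ d → sym (trans (g≡ _) (cong (to f) (transpose-involutive x y d))))
    (λ r → orbits-split f x≢y xy (reach-cong g≡ r))

  eulerSum : (D ↣ D) → (D ↣ D) → ℕ
  eulerSum σ α = orbits σ + orbits α + orbits (σ ↣-∘ α)

  NonnegativeGenus : (D ↣ D) → (D ↣ D) → Set
  NonnegativeGenus σ α = eulerSum σ α ≤ size + (components σ α + components σ α)

  Spherical : (D ↣ D) → (D ↣ D) → Set
  Spherical σ α = eulerSum σ α ≡ size + (components σ α + components σ α)

  Splits : (σ α σ′ α′ : D ↣ D) → Set
  Splits σ α σ′ α′ = SplitStep (eulerSum σ α) (components σ α) (eulerSum σ′ α′) (components σ′ α′)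

  components-cong : ∀ σ α σ′ α′ → (∀ d → to σ d ≡ to σ′ d) → (∀ d → to α d ≡ to α′ d) →
    components σ α ≡ components σ′ α′
  components-cong σ α σ′ α′ eqσ eqα = #-cong (conn-isDecEquivalence σ α) (conn-isDecEquivalence σ′ α′)
    (λ _ _ → conn-fold (conn-isEquivalence σ′ α′)
      (λ d → subst (Conn _ _ d) (sym (eqσ d)) (stepσ here)) (λ d → subst (Conn _ _ d) (sym (eqα d)) (stepα here)))
    (λ _ _ → conn-fold (conn-isEquivalence σ α)
      (λ d → subst (Conn _ _ d) (eqσ d) (stepσ here)) (λ d → subst (Conn _ _ d) (eqα d) (stepα here)))

  spherical-cong : ∀ {σ α σ′ α′} → (∀ d → to σ d ≡ to σ′ d) → (∀ d → to α d ≡ to α′ d) →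
    Spherical σ α → Spherical σ′ α′
  spherical-cong {σ} {α} {σ′} {α′} eqσ eqα eq = begin
    eulerSum σ′ α′ ≡⟨ cong₂ _+_ (cong₂ _+_ (orbits-cong σ σ′ eqσ) (orbits-cong α α′ eqα))
                        (orbits-cong (σ ↣-∘ α) (σ′ ↣-∘ α′) (λ d → trans (cong (to σ) (eqα d)) (eqσ _))) ⟨
    eulerSum σ α ≡⟨ eq ⟩
    size + (components σ α + components σ α)
      ≡⟨ cong (λ c → size + (c + c)) (components-cong σ α σ′ α′ eqσ eqα) ⟩
    size + (components σ′ α′ + components σ′ α′) ∎
    where open ≡-Reasoning

  module _ (p p′ q q′ : D ↣ D) {C C′ : Rel D 0ℓ} (decC : IsDecEquivalence C) (decC′ : IsDecEquivalence C′)
           {x y u v : D} (x≢y : x ≢ y) (u≢v : u ≢ v) (px : P x) (py : P y) (pu : P u) (pv : P v)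
           (p≡ : ∀ d → to p′ d ≡ to p (transpose x y d)) (q≡ : ∀ d → to q′ d ≡ to q (transpose u v d))
           (xy : Reach (to p) x y) (C-xy : C x y)
           (C⊆ : ∀ {d e} → C d e → Merge C′ x y d e) (C′⊆C : ∀ {d e} → C′ d e → C d e)
           (uv⇒C′ : Reach (to q′) u v → C′ x y) where

    -- The common core of the three surgeries: `p` and `q` are the altered permutations, `p` is
    -- known to split, and the third one is kept. The hypotheses make `C` the relation `C′` with `x`
    -- and `y` reconnected, so only the effect on `q` has to be distinguished.
    splitStep : SplitStep (orbits p + orbits q) (# decC) (orbits p′ + orbits q′) (# decC′)
    splitStep with IsDecEquivalence._≟_ (reach-isDecEquivalence q) u v
    -- `q` joins `u` and `v`, which offsets the split of `p`; the joined orbit shows, by `uv⇒C′`,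
    -- that `x` and `y` stay connected.
    ... | no ¬uv = inj₂ (trans (cong (_+ orbits q′) p-split) (trans (sym (ℕₚ.+-suc (orbits p) (orbits q′)))
            (cong (orbits p +_) (sym (orbits-joined q q′ u≢v pu pv q≡ ¬uv)))) , joined-C)
      where
      p-split = orbits-divided p p′ x≢y px py p≡ xy
      C′-xy = uv⇒C′ (reach-cong (λ d → sym (q≡ d)) (orbits-join q u≢v ¬uv))
      joined-C = #-cong decC′ decC (λ _ _ → C′⊆C) (λ _ _ c → merge-fold
        (IsDecEquivalence.isEquivalence decC′) (IsDecEquivalence.isEquivalence decC′) id C′-xy (C⊆ c))
    -- Both permutations split, a gain of 2. Reconnecting `x` and `y` restores `C`, so at most one
    -- component came apart.
    ... | yes uv = inj₁ (trans (cong₂ _+_ p-split q-split) (ℕₚ.+-suc (suc (orbits p)) (orbits q)) , c′≤)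
      where
      p-split = orbits-divided p p′ x≢y px py p≡ xy
      q-split = orbits-divided q q′ u≢v pu pv q≡ uv
      C′-equiv = IsDecEquivalence.isEquivalence decC′
      c′≤ : # decC′ ≤ suc (# decC)
      c′≤ with IsDecEquivalence._≟_ decC′ x y
      ... | yes c = ℕₚ.≤-trans (ℕₚ.≤-reflexive
              (#-cong decC′ decC (λ _ _ → C′⊆C) (λ _ _ d → merge-fold C′-equiv C′-equiv id c (C⊆ d)))) (ℕₚ.n≤1+n _)
      ... | no ¬c = ℕₚ.≤-reflexive (#-merge decC′ decC px py ¬c
              (merge-fold C′-equiv (IsDecEquivalence.isEquivalence decC) C′⊆C C-xy) C⊆)

-- Surgeries that alter two of the three permutations

transpose-related : ⦃ _ : Finite D ⦄ → {S : Rel D 0ℓ} → IsEquivalence S → ∀ {x y} → S x y →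
  ∀ d → S d (transpose x y d)
transpose-related {S = S} S-equiv xy = transpose-elim S xy (sym′ xy) (λ _ _ → refl′)
  where open IsEquivalence S-equiv renaming (refl to refl′; sym to sym′)

private
  splitStep-resp : ∀ {s c s′ c′} r {t t′} → s + r ≡ t → s′ + r ≡ t′ →
    SplitStep s c s′ c′ → SplitStep t c t′ c′
  splitStep-resp r refl refl (inj₁ (refl , le)) = inj₁ (refl , le)
  splitStep-resp r refl refl (inj₂ (refl , eq)) = inj₂ (refl , eq)

  keepFirst : ∀ a b r → a + b + r ≡ r + a + b
  keepFirst = solve-∀

  keepSecond : ∀ a b r → a + b + r ≡ a + r + b
  keepSecond = solve-∀

module Surgery ⦃ fin : Finite D ⦄ {P : D → Set} (P? : Decidable P) where
  open Euler P?

  module _ (σ α : D ↣ D) {x y : D} (x≢y : x ≢ y) (px : P x) (py : P y) where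
    private
      C = Conn (to σ) (to α)
      C-equiv = conn-isEquivalence σ α
      module C = IsEquivalence C-equiv

    -- The face permutation is `σ` after `α`, so multiplying `α` on the right by a transposition
    -- multiplies the faces by the same one.
    split-keepingσ : Reach (to α) x y → Splits σ α σ (α ↣-∘ transposition x y)
    split-keepingσ xy = splitStep-resp (orbits σ) (keepFirst (orbits α) (orbits (σ ↣-∘ α)) (orbits σ))
        (keepFirst (orbits α′) (orbits (σ ↣-∘ α′)) (orbits σ))
        (splitStep α α′ (σ ↣-∘ α) (σ ↣-∘ α′) (conn-isDecEquivalence σ α) (conn-isDecEquivalence σ α′)
          x≢y x≢y px py px py (λ _ → refl) (λ _ → refl) xy (reach⇒connα xy)
          (conn-fold M-equiv (λ _ → inj₁ (stepσ here)) (λ d → M.trans (transpose-related M-equiv M-xy d)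
            (inj₁ (subst (Conn _ _ _) (cong (to α) (transpose-involutive x y d)) (stepα here)))))
          (conn-fold C-equiv (λ _ → stepσ here)
            (λ d → C.trans (transpose-related C-equiv (reach⇒connα xy) d) (stepα here)))
          reach⇒connφ)
      where
      α′ = α ↣-∘ transposition x y
      M-equiv = merge-isEquivalence (conn-isEquivalence σ α′) x y
      module M = IsEquivalence M-equiv
      M-xy : Merge (Conn (to σ) (to α′)) x y x y
      M-xy = inj₂ (inj₁ (here , here))

    module _ {u v : D} (αu≡x : to α u ≡ x) (αv≡y : to α v ≡ y) (pu : P u) (pv : P v)
             (xy : Reach (to σ) x y) where
      private
        σ′ = σ ↣-∘ transposition x y

        u≢v : u ≢ v
        u≢v u≡v = x≢y (trans (sym αu≡x) (trans (cong (to α) u≡v) αv≡y))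

        conjugate : ∀ d → transpose x y (to α d) ≡ to α (transpose u v d)
        conjugate d = subst₂ (λ x y → transpose x y (to α d) ≡ to α (transpose u v d)) αu≡x αv≡y
          (transpose-conjugate α u v d)

        C-xy : C x y
        C-xy = reach⇒connσ xy

      -- Moved past `α`, the transposition of `x` and `y` becomes that of their preimages `u` and
      -- `v`; this is the one that acts on the faces.
      split-keepingα : Splits σ α σ′ α
      split-keepingα = splitStep-resp (orbits α) (keepSecond (orbits σ) (orbits (σ ↣-∘ α)) (orbits α))
          (keepSecond (orbits σ′) (orbits (σ′ ↣-∘ α)) (orbits α))
          (splitStep σ σ′ (σ ↣-∘ α) (σ′ ↣-∘ α) (conn-isDecEquivalence σ α) (conn-isDecEquivalence σ′ α)
            x≢y u≢v px py pu pv (λ _ → refl) (λ d → cong (to σ) (conjugate d)) xy C-xy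
            (conn-fold M-equiv (λ d → M.trans (transpose-related M-equiv M-xy d)
              (inj₁ (subst (Conn _ _ _) (cong (to σ) (transpose-involutive x y d)) (stepσ here))))
              (λ _ → inj₁ (stepα here)))
            (conn-fold C-equiv (λ d → C.trans (transpose-related C-equiv C-xy d) (stepσ here)) (λ _ → stepα here))
            (λ uv → subst₂ (Conn _ _) αu≡x αv≡y
              (conn-trans (conn-sym σ′ α (stepα here)) (conn-trans (reach⇒connφ uv) (stepα here)))))
        where
        M-equiv = merge-isEquivalence (conn-isEquivalence σ′ α) x y
        module M = IsEquivalence M-equiv
        M-xy : Merge (Conn (to σ′) (to α)) x y x y
        M-xy = inj₂ (inj₁ (here , here))

      -- The transposition enters on the right of `σ` and on the left of `α`, and the two copies
      -- cancel in the face permutation. Seen from the right, `α` is multiplied by the transposition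
      -- of `u` and `v`.
      split-keepingφ : Splits σ α σ′ (transposition x y ↣-∘ α)
      split-keepingφ = splitStep-resp (orbits (σ ↣-∘ α)) refl
          (cong (orbits σ′ + orbits α′ +_)
            (orbits-cong (σ ↣-∘ α) (σ′ ↣-∘ α′) (λ d → cong (to σ) (sym (transpose-involutive x y _)))))
          (splitStep σ σ′ α α′ (conn-isDecEquivalence σ α) (conn-isDecEquivalence σ′ α′)
            x≢y u≢v px py pu pv (λ _ → refl) conjugate xy C-xy
            (conn-fold M-equiv
              (λ d → M.trans (transpose-related M-equiv M-xy d)
                (inj₁ (subst (Conn _ _ _) (cong (to σ) (transpose-involutive x y d)) (stepσ here))))
              (λ d → M.trans (inj₁ (stepα here)) (subst (Merge (Conn (to σ′) (to α′)) x y (to α′ d))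
                (transpose-involutive x y _) (transpose-related M-equiv M-xy (to α′ d)))))
            (conn-fold C-equiv (λ d → C.trans (transpose-related C-equiv C-xy d) (stepσ here))
              (λ d → C.trans (stepα here) (transpose-related C-equiv C-xy _)))
            -- `α′` sends `u` to `y` and `v` to `x`, so the connection is obtained in the reversed
            -- direction.
            (λ uv → conn-sym σ′ α′ (subst₂ (Conn _ _)
              (trans (cong (transpose x y) αu≡x) (transpose-left x y))
              (trans (cong (transpose x y) αv≡y) (transpose-right x y))
              (conn-trans (conn-sym σ′ α′ (stepα here)) (conn-trans (reach⇒connα uv) (stepα here))))))
        where
        α′ = transposition x y ↣-∘ α
        M-equiv = merge-isEquivalence (conn-isEquivalence σ′ α′) x y
        module M = IsEquivalence M-equiv
        M-xy : Merge (Conn (to σ′) (to α′)) x y x y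
        M-xy = inj₂ (inj₁ (here , here))

  -- Ree's inequality: splitting darts off α one at a time reduces it to α = id.
  nonnegativeGenus : ∀ σ α → (∀ {d} → P d → P (to σ d)) → (∀ {d} → P d → P (to α d)) →
    NonnegativeGenus σ α
  nonnegativeGenus σ α closedσ closedα = go elements α closedα (λ _ d∉ → contradiction (complete _) d∉)
    where
    go : ∀ L α → (∀ {d} → P d → P (to α d)) → (∀ {d} → P d → d ∉ L → to α d ≡ d) → NonnegativeGenus σ α
    -- Now `α` is the identity on `P`: it has as many orbits as there are darts, and faces,
    -- components and orbits of `σ` coincide, so equality holds.
    go [] α closedα fixed = ℕₚ.≤-reflexive (begin
      orbits σ + orbits α + orbits (σ ↣-∘ α) ≡⟨ cong₂ (λ a f → orbits σ + a + f) α-trivial φ-trivial ⟩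
      orbits σ + size + orbits σ ≡⟨ rotate (orbits σ) size ⟩
      size + (orbits σ + orbits σ) ≡⟨ cong (λ c → size + (c + c)) conn-trivial ⟨
      size + (components σ α + components σ α) ∎)
      where
      open ≡-Reasoning
      rotate : ∀ a b → a + b + a ≡ b + (a + a)
      rotate = solve-∀

      reach-on : ∀ {f g : D → D} → (∀ {d} → P d → P (f d)) → (∀ {d} → P d → f d ≡ g d) →
        ∀ {d e} → P d → Reach f d e → Reach g d e
      reach-on {f} {g} closed eq = reach-mapOn {f = f} {g = g} id P closed eq

      α-trivial : orbits α ≡ size
      α-trivial = #-cong (reach-isDecEquivalence α) ≡-isDecEquivalence
        (λ pd _ r → reach-fold isEquivalence (λ _ → refl) (reach-on closedα (λ p → fixed p λ ()) pd r))
        (λ { _ _ refl → reach-refl })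

      φ≡σ : ∀ {d} → P d → to σ (to α d) ≡ to σ d
      φ≡σ pd = cong (to σ) (fixed pd λ ())

      φ-trivial : orbits (σ ↣-∘ α) ≡ orbits σ
      φ-trivial = #-cong (reach-isDecEquivalence (σ ↣-∘ α)) (reach-isDecEquivalence σ)
        (λ pd _ → reach-on (closedσ ∘ closedα) φ≡σ pd)
        (λ pd _ → reach-on closedσ (sym ∘ φ≡σ) pd)

      conn-trivial : components σ α ≡ orbits σ
      conn-trivial = #-cong (conn-isDecEquivalence σ α) (reach-isDecEquivalence σ)
        (λ pd _ → proj₂ ∘ conn⇒reach pd) (λ _ _ → reach⇒connσ)
        where
        conn⇒reach : ∀ {d e} → P d → Conn (to σ) (to α) d e → P e × Reach (to σ) d e
        conn⇒reach pd here = pd , reach-refl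
        conn⇒reach pd (stepσ c) = let pe , r = conn⇒reach pd c in closedσ pe , reach-trans r (reach-step (to σ) _)
        conn⇒reach pd (stepα c) = let pe , r = conn⇒reach pd c in
          closedα pe , reach-trans r (0 , sym (fixed pe λ ()))
    go (x ∷ L) α closedα fixed with P? x | to α x ≟ x
    ... | no ¬px | _ = go L α closedα λ pd d∉ → fixed pd
            λ { (here refl) → ¬px pd ; (there d∈) → d∉ d∈ }
    ... | yes px | yes αx≡x = go L α closedα λ {d} pd d∉ → fixed′ d pd d∉
      where
      fixed′ : ∀ d → P d → d ∉ L → to α d ≡ d
      fixed′ d pd d∉ with d ≟ x
      ... | yes refl = αx≡x
      ... | no d≢x = fixed pd λ { (here d≡x) → d≢x d≡x ; (there d∈) → d∉ d∈ }
    ... | yes px | no αx≢x = splitStep-≤ {n = size} (split-keepingσ σ α x≢y px py xy) (go L α′ closedα′ fixed′)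
      where
      -- With `y` the preimage of `x`, the new flip fixes `x`. The dart `y` was not fixed before,
      -- hence lies in `L`, so no dart already split off is disturbed.
      y = inverse α x
      αy≡x = inverseʳ α x
      α′ = α ↣-∘ transposition x y

      x≢y : x ≢ y
      x≢y x≡y = αx≢x (trans (cong (to α) x≡y) αy≡x)

      xy : Reach (to α) x y
      xy = reach-sym α (1 , αy≡x)

      py : P y
      py = reach-closed {P = P} closedα px xy

      closedα′ : ∀ {d} → P d → P (to α′ d)
      closedα′ {d} = transpose-elim (λ d e → P d → P (to α e)) (λ _ → closedα py) (λ _ → closedα px)
        (λ _ _ → closedα) d

      fixed′ : ∀ {d} → P d → d ∉ L → to α′ d ≡ d
      fixed′ {d} pd d∉ = transpose-elim (λ d e → P d → d ∉ L → to α e ≡ d)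
        (λ _ _ → αy≡x)
        (λ py y∉ → contradiction (trans (sym αy≡x) (fixed py λ { (here y≡x) → x≢y (sym y≡x) ; (there y∈) → y∉ y∈ })) x≢y)
        (λ d≢x _ pd d∉ → fixed pd λ { (here d≡x) → d≢x d≡x ; (there d∈) → d∉ d∈ }) d pd d∉

  splits-spherical : ∀ {σ α σ′ α′} → (∀ {d} → P d → P (to σ′ d)) → (∀ {d} → P d → P (to α′ d)) →
    Splits σ α σ′ α′ → Spherical σ α → Spherical σ′ α′
  splits-spherical closedσ closedα split sph =
    splitStep-≡ {n = size} split sph (nonnegativeGenus _ _ closedσ closedα)

-- Local and global Euler characteristic

module Global (D : Set) ⦃ fin : Finite D ⦄ where
  open Euler {D = D} {P = λ _ → ⊤} (λ _ → yes tt) public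
  open Surgery {D = D} {P = λ _ → ⊤} (λ _ → yes tt) public

-- The condition `euler` of `PlanarRotation`, for an arbitrary pair of maps.
LocallySpherical : (σ α : D → D) → D → Set
LocallySpherical σ α d₀ = Σ ℕ λ V → Σ ℕ λ E → Σ ℕ λ F →
  NumClasses (Reach σ) (Conn σ α d₀) V ×
  NumClasses (Reach α) (Conn σ α d₀) E ×
  NumClasses (Reach (λ d → σ (α d))) (Conn σ α d₀) F ×
  V + F ≡ E + 2

related⇒sameIndex : ∀ {R : Rel D 0ℓ} → IsEquivalence R → ∀ {L} → AllPairs (λ x y → ¬ R x y) L →
  ∀ {i j} → R (lookup L i) (lookup L j) → i ≡ j
related⇒sameIndex R-equiv (x∉ ∷ ap) {zero} {zero} r = refl
related⇒sameIndex R-equiv (x∉ ∷ ap) {zero} {suc j} r = contradiction r (All.lookup x∉ (Memₚ.∈-lookup j))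
related⇒sameIndex R-equiv (x∉ ∷ ap) {suc i} {zero} r =
  contradiction (IsEquivalence.sym R-equiv r) (All.lookup x∉ (Memₚ.∈-lookup i))
related⇒sameIndex R-equiv (x∉ ∷ ap) {suc i} {suc j} r = cong suc (related⇒sameIndex R-equiv ap r)

related⇒≡ : ∀ {R : Rel D 0ℓ} → IsEquivalence R → ∀ {L} → AllPairs (λ x y → ¬ R x y) L →
  ∀ {x y} → x ∈ L → y ∈ L → R x y → x ≡ y
related⇒≡ {R = R} R-equiv {L} ap p q r = trans (Anyₚ.lookup-index p) (trans
  (cong (lookup L) (related⇒sameIndex R-equiv ap (subst₂ R (Anyₚ.lookup-index p) (Anyₚ.lookup-index q) r)))
  (sym (Anyₚ.lookup-index q)))

reach-involution : ∀ {α : D → D} → (∀ d → α (α d) ≡ d) → ∀ {d e} → Reach α d e → d ≡ e ⊎ α d ≡ e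
reach-involution inv (zero , refl) = inj₁ refl
reach-involution {α = α} inv {d} (suc k , refl) with reach-involution {α = α} inv {d} (k , refl)
... | inj₁ eq = inj₂ (cong α eq)
... | inj₂ eq = inj₁ (trans (sym (inv d)) (cong α eq))

module _ ⦃ fin : Finite D ⦄ (α : D ↣ D) (inv : ∀ d → to α (to α d) ≡ d) where

  -- An involution without fixed points pairs the darts, so representatives of its orbits together
  -- with their images list every dart exactly once.
  numDarts : {P : D → Set} → (∀ {d} → P d → P (to α d)) → (∀ {d} → P d → to α d ≢ d) →
    ∀ {k} → NumClasses (Reach (to α)) P k → NumClasses _≡_ P (k + k)
  numDarts {P} closed fpf (L , refl , inP , ap , cover) =
    L ++ map (to α) L ,
    trans (Listₚ.length-++ L) (cong (length L +_) (Listₚ.length-map (to α) L)) ,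
    Allₚ.++⁺ inP (Allₚ.map⁺ (All.map closed inP)) ,
    AllPairsₚ.++⁺ distinct (AllPairsₚ.map⁺ (AllPairs.map (λ x≢y → x≢y ∘ injective α) distinct))
      (All.tabulate λ x∈ → Allₚ.map⁺ (All.tabulate (across x∈))) ,
    λ z pz → covering (cover z pz)
    where
    distinct : AllPairs _≢_ L
    distinct = AllPairs.map (λ { ¬r refl → ¬r reach-refl }) ap

    across : ∀ {x} → x ∈ L → ∀ {y} → y ∈ L → x ≢ to α y
    across {x} x∈ {y} y∈ x≡αy = fpf (All.lookup inP y∈) (trans (sym x≡αy)
      (sym (related⇒≡ (reach-isEquivalence α) ap y∈ x∈ (1 , sym x≡αy))))

    covering : ∀ {K z} → Any (λ r → Reach (to α) r z) K → Any (_≡ z) (K ++ map (to α) K)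
    covering {r ∷ K} (here r~z) with reach-involution {α = to α} inv r~z
    ... | inj₁ eq = here eq
    ... | inj₂ eq = there (Anyₚ.++⁺ʳ K (here eq))
    covering {r ∷ K} (there p) with Anyₚ.++⁻ K (covering p)
    ... | inj₁ q = there (Anyₚ.++⁺ˡ q)
    ... | inj₂ q = there (Anyₚ.++⁺ʳ K (there q))

module _ ⦃ fin : Finite D ⦄ (σ α : D ↣ D) (inv : ∀ d → to α (to α d) ≡ d) where
  private
    C = Conn (to σ) (to α)
    C-equiv = conn-isEquivalence σ α
    module C = IsEquivalence C-equiv

  -- Summing V + F = E + 2 over representatives of the components gives V + F = E + 2c. Adding E on
  -- both sides yields the global equation, because there are 2E darts.
  locallySpherical⇒spherical : (∀ d → to α d ≢ d) → (∀ d₀ → LocallySpherical (to σ) (to α) d₀) →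
    Global.Spherical D σ α
  locallySpherical⇒spherical fpf local with Global.#-spec D (conn-isDecEquivalence σ α)
  ... | L , length-L , _ , ap , cover =
    let V , E , F , v , e , f , eq = sumUp L ap in
    begin
      orbits σ + orbits α + orbits (σ ↣-∘ α)
        ≡⟨ cong₂ _+_ (cong₂ _+_ (count (reach-isDecEquivalence σ) v) (count (reach-isDecEquivalence α) e))
                     (count (reach-isDecEquivalence (σ ↣-∘ α)) f) ⟩
      V + E + F ≡⟨ swap-last V E F ⟩
      V + F + E ≡⟨ cong (_+ E) eq ⟩
      E + (length L + length L) + E ≡⟨ swap-last E _ E ⟩
      E + E + (length L + length L) ≡⟨ cong₂ (λ n c → n + (c + c))
        (count ≡-isDecEquivalence (numDarts α inv (Any.map stepα) (λ {d} _ → fpf d) e)) (sym length-L) ⟨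
      size + (components σ α + components σ α) ∎
    where
    open Global D
    open ≡-Reasoning

    swap-last : ∀ a b c → a + b + c ≡ a + c + b
    swap-last = solve-∀

    In : List D → D → Set
    In K d = Any (λ r → C r d) K

    count : ∀ {R k} (dec : IsDecEquivalence R) → NumClasses R (In L) k → # dec ≡ k
    count dec nc = numClasses-unique (IsDecEquivalence.isEquivalence dec) (#-spec dec)
      (numClasses-pred (λ _ → tt) (λ {x} _ → cover x tt) nc)

    sumUp : ∀ K → AllPairs (λ x y → ¬ C x y) K → Σ ℕ λ V → Σ ℕ λ E → Σ ℕ λ F →
      NumClasses (Reach (to σ)) (In K) V × NumClasses (Reach (to α)) (In K) E ×
      NumClasses (Reach (to (σ ↣-∘ α))) (In K) F × V + F ≡ E + (length K + length K)
    sumUp [] [] = 0 , 0 , 0 , none , none , none , refl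
      where
      none : ∀ {R} → NumClasses R (In []) 0
      none = [] , refl , [] , [] , λ _ ()
    sumUp (r ∷ K) (r∉ ∷ ap) =
      let V₁ , E₁ , F₁ , v₁ , e₁ , f₁ , eq₁ = local r
          V₂ , E₂ , F₂ , v₂ , e₂ , f₂ , eq₂ = sumUp K ap
      in V₁ + V₂ , E₁ + E₂ , F₁ + F₂ ,
         union reach⇒connσ v₁ v₂ , union reach⇒connα e₁ e₂ , union reach⇒connφ f₁ f₂ ,
         trans (interchange V₁ V₂ F₁ F₂) (trans (cong₂ _+_ eq₁ eq₂) (regroup E₁ E₂ (length K)))
      where
      interchange : ∀ a b c d → a + b + (c + d) ≡ a + c + (b + d)
      interchange = solve-∀
      regroup : ∀ a b l → a + 2 + (b + (l + l)) ≡ a + b + (suc l + suc l)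
      regroup = solve-∀

      union : ∀ {R j k} → (∀ {x y} → R x y → C x y) →
        NumClasses R (C r) j → NumClasses R (In K) k → NumClasses R (In (r ∷ K)) (j + k)
      union R⊆C nc₁ nc₂ = numClasses-pred [ here , there ]
        (λ { (here c) → inj₁ c ; (there p) → inj₂ p })
        (numClasses-∪ (λ rx sy xy → let ¬rs , sy′ = All.lookupAny r∉ sy
           in ¬rs (C.trans rx (C.trans (R⊆C xy) (C.sym sy′)))) nc₁ nc₂)

  -- By Ree's inequality the component of `d₀` and its complement both have nonnegative defect. The
  -- defects add up to zero, so each vanishes. Fixed points of `α` are excluded on this component
  -- only, since discarded darts may sit in others.
  spherical⇒locallySpherical : ∀ d₀ → (∀ {d} → C d₀ d → to α d ≢ d) →
    Global.Spherical D σ α → LocallySpherical (to σ) (to α) d₀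
  spherical⇒locallySpherical d₀ fpf sph =
    I.orbits σ , I.orbits α , I.orbits (σ ↣-∘ α) ,
    I.#-spec (reach-isDecEquivalence σ) , I.#-spec (reach-isDecEquivalence α) ,
    I.#-spec (reach-isDecEquivalence (σ ↣-∘ α)) ,
    ℕₚ.+-cancelʳ-≡ (I.orbits α) _ _ (begin
      I.orbits σ + I.orbits (σ ↣-∘ α) + I.orbits α ≡⟨ swap-last (I.orbits σ) (I.orbits (σ ↣-∘ α)) (I.orbits α) ⟩
      I.orbits σ + I.orbits α + I.orbits (σ ↣-∘ α) ≡⟨ inside ⟩
      I.size + (I.components σ α + I.components σ α) ≡⟨ cong₂ (λ n c → n + (c + c)) darts one ⟩
      I.orbits α + I.orbits α + 2 ≡⟨ swap-last (I.orbits α) (I.orbits α) 2 ⟩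
      I.orbits α + 2 + I.orbits α ∎)
    where
    open ≡-Reasoning
    P? = IsDecEquivalence._≟_ (conn-isDecEquivalence σ α) d₀
    module I = Euler P?
    module O = Euler (λ d → ¬? (P? d))
    module G = Global D

    swap-last : ∀ a b c → a + b + c ≡ a + c + b
    swap-last = solve-∀

    additive : ∀ {R} (dec : IsDecEquivalence R) → (∀ {x y} → R x y → C x y) → I.# dec + O.# dec ≡ G.# dec
    additive {R} dec R⊆C = numClasses-unique (IsDecEquivalence.isEquivalence dec)
      (numClasses-pred (λ _ → tt) (λ {x} _ → decide (P? x))
        (numClasses-∪ (λ dx ¬dy xy → ¬dy (C.trans dx (R⊆C xy))) (I.#-spec dec) (O.#-spec dec)))
      (G.#-spec dec)
      where
      decide : ∀ {x} → Dec (C d₀ x) → C d₀ x ⊎ ¬ C d₀ x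
      decide (yes c) = inj₁ c
      decide (no ¬c) = inj₂ ¬c

    tight : ∀ {a b a′ b′} → a ≤ b → a′ ≤ b′ → a + a′ ≡ b + b′ → a ≡ b
    tight {a} {b} {a′} {b′} a≤b a′≤b′ eq = ℕₚ.≤-antisym a≤b (ℕₚ.+-cancelʳ-≤ b′ b a
      (ℕₚ.≤-trans (ℕₚ.≤-reflexive (sym eq)) (ℕₚ.+-monoʳ-≤ a a′≤b′)))

    inside : I.Spherical σ α
    inside = tight
      (Surgery.nonnegativeGenus P? σ α stepσ stepα)
      (Surgery.nonnegativeGenus (λ d → ¬? (P? d)) σ α
        (λ ¬c c → ¬c (C.trans c (C.sym (stepσ here)))) (λ ¬c c → ¬c (C.trans c (C.sym (stepα here)))))
      (begin
        I.eulerSum σ α + O.eulerSum σ α ≡⟨ regroup₁ (I.orbits σ) (I.orbits α) _ (O.orbits σ) (O.orbits α) _ ⟩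
        (I.orbits σ + O.orbits σ) + (I.orbits α + O.orbits α) + (I.orbits (σ ↣-∘ α) + O.orbits (σ ↣-∘ α))
          ≡⟨ cong₂ _+_ (cong₂ _+_ (additive (reach-isDecEquivalence σ) reach⇒connσ)
               (additive (reach-isDecEquivalence α) reach⇒connα))
               (additive (reach-isDecEquivalence (σ ↣-∘ α)) reach⇒connφ) ⟩
        G.eulerSum σ α ≡⟨ sph ⟩
        G.size + (G.components σ α + G.components σ α)
          ≡⟨ cong₂ (λ n c → n + (c + c)) (additive ≡-isDecEquivalence (λ { refl → here }))
               (additive (conn-isDecEquivalence σ α) id) ⟨
        (I.size + O.size) + ((I.components σ α + O.components σ α) + (I.components σ α + O.components σ α))
          ≡⟨ regroup₂ I.size O.size (I.components σ α) (O.components σ α) ⟩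
        (I.size + (I.components σ α + I.components σ α)) + (O.size + (O.components σ α + O.components σ α)) ∎)
      where
      regroup₁ : ∀ a b c d e f → (a + b + c) + (d + e + f) ≡ (a + d) + (b + e) + (c + f)
      regroup₁ = solve-∀
      regroup₂ : ∀ n m c d → (n + m) + ((c + d) + (c + d)) ≡ (n + (c + c)) + (m + (d + d))
      regroup₂ = solve-∀

    one : I.components σ α ≡ 1
    one = numClasses-unique C-equiv (I.#-spec (conn-isDecEquivalence σ α))
      (d₀ ∷ [] , refl , here ∷ [] , [] ∷ [] , λ _ c → here c)

    darts : I.size ≡ I.orbits α + I.orbits α
    darts = numClasses-unique isEquivalence (I.#-spec ≡-isDecEquivalence)
      (numDarts α inv stepα fpf (I.#-spec (reach-isDecEquivalence α)))

-- Combinatorial maps and multigraphs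

involution : {α : D → D} → (∀ d → α (α d) ≡ d) → D ↣ D
involution {α = α} inv = mk↣ λ {d} {e} eq → trans (sym (inv d)) (trans (cong α eq) (inv e))

-- The fixed points of α are discarded darts; edges are the orbits of α on the live ones.
record PlanarMap (D : Set) ⦃ _ : Finite D ⦄ (N : ℕ) : Set where
  field
    rot flip : D ↣ D
    vertex   : D → Fin N

  Live : D → Set
  Live d = to flip d ≢ d

  field
    flip-involutive : ∀ d → to flip (to flip d) ≡ d
    rot-live        : ∀ {d} → Live d → Live (to rot d)
    rot-vertex      : ∀ d → vertex (to rot d) ≡ vertex d
    rot-transitive  : ∀ {d e} → Live d → Live e → vertex d ≡ vertex e → Reach (to rot) d e
    spherical       : Global.Spherical D rot flip

  live? : Decidable Live
  live? d = ¬? (to flip d ≟ d)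

  flip-live : ∀ {d} → Live d → Live (to flip d)
  flip-live live eq = live (injective flip eq)

  At : Fin N → D → Set
  At w d = Live d × vertex d ≡ w

  Valency : Fin N → ℕ → Set
  Valency w k = NumClasses _≡_ (At w) k

-- An embedding of `H` expressed on darts, each edge being directed from its first to its second
-- end. The two injectivity conditions together say that different edges of `H` occupy different
-- orbits of the flip, in whichever directions they run.
record Carries {D : Set} ⦃ fin : Finite D ⦄ (H : Multigraph n) (M : PlanarMap D N) (f : Fin n → Fin N) : Set where
  open PlanarMap M
  field
    dart        : Fin (m H) → D
    dart-live   : ∀ e → Live (dart e)
    dart-source : ∀ e → vertex (dart e) ≡ f (proj₁ (ends H e))
    dart-target : ∀ e → vertex (to flip (dart e)) ≡ f (proj₂ (ends H e))
    dart-injective      : ∀ {e e′} → dart e ≡ dart e′ → e ≡ e′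
    dart-flip-injective : ∀ {e e′} → dart e ≡ to flip (dart e′) → e ≡ e′

-- `Q` lies in the image of `ι`, so representatives can be exchanged for preimages. This carries
-- counts from the live darts of a map to the darts of the multigraph built from it.
numClasses-pullback : ∀ {A B : Set} {R : Rel A 0ℓ} {S : Rel B 0ℓ} {P : A → Set} {Q : B → Set} {k} (ι : A → B) →
  (∀ {x y} → R x y → S (ι x) (ι y)) → (∀ {x y} → S (ι x) (ι y) → R x y) →
  (∀ {x} → P x → Q (ι x)) → (∀ {x} → Q (ι x) → P x) → (∀ {y} → Q y → ∃ λ x → ι x ≡ y) →
  NumClasses S Q k → NumClasses R P k
numClasses-pullback {A = A} {Q = Q} ι preserve reflect P⇒Q Q⇒P onto (L , length-L , inQ , ap , cover)
  with preimages inQ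
  where
  preimages : ∀ {L} → All Q L → ∃ λ (K : List A) → map ι K ≡ L
  preimages [] = [] , refl
  preimages (q ∷ qs) = let x , eq = onto q ; K , eqs = preimages qs in x ∷ K , cong₂ _∷_ eq eqs
... | K , refl = K , trans (sym (Listₚ.length-map ι K)) length-L , All.map Q⇒P (Allₚ.map⁻ inQ) ,
  AllPairs.map (λ ¬S r → ¬S (preserve r)) (AllPairsₚ.map⁻ ap) ,
  λ x px → Any.map reflect (Anyₚ.map⁻ (cover (ι x) (P⇒Q px)))

module _ (G : Multigraph n) where

  private
    -- A loop at `v` has both of its darts there, which accounts for its contribution of 2.
    endsAt-darts : ∀ v e → NumClasses _≡_ (λ d → head G d ≡ v × proj₁ d ≡ e) (endsAt G v e)
    endsAt-darts v e with proj₁ (ends G e) Finₚ.≟ v | proj₂ (ends G e) Finₚ.≟ v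
    ... | yes p | yes q = (e , false) ∷ (e , true) ∷ [] , refl , (p , refl) ∷ (q , refl) ∷ [] ,
            ((λ ()) ∷ []) ∷ [] ∷ [] ,
            λ { (_ , false) (_ , refl) → here refl ; (_ , true) (_ , refl) → there (here refl) }
    ... | yes p | no ¬q = (e , false) ∷ [] , refl , (p , refl) ∷ [] , [] ∷ [] ,
            λ { (_ , false) (_ , refl) → here refl ; (_ , true) (q , refl) → contradiction q ¬q }
    ... | no ¬p | yes q = (e , true) ∷ [] , refl , (q , refl) ∷ [] , [] ∷ [] ,
            λ { (_ , false) (p , refl) → contradiction p ¬p ; (_ , true) (_ , refl) → here refl }
    ... | no ¬p | no ¬q = [] , refl , [] , [] ,
            λ { (_ , false) (p , refl) → contradiction p ¬p ; (_ , true) (q , refl) → contradiction q ¬q }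

  degree-darts : ∀ v → NumClasses _≡_ (λ d → head G d ≡ v) (degree G v)
  degree-darts v = numClasses-pred proj₁ (λ {d} h → h , complete (proj₁ d))
    (sumUp (allFin (m G)) (Uniqueₚ.allFin⁺ (m G)))
    where
    sumUp : ∀ es → Unique es → NumClasses _≡_ (λ d → head G d ≡ v × proj₁ d ∈ es) (sum (map (endsAt G v) es))
    sumUp [] [] = [] , refl , [] , [] , λ { _ (_ , ()) }
    sumUp (e ∷ es) (e∉ ∷ u) = numClasses-pred
      [ (λ (h , eq) → h , here eq) , (λ (h , p) → h , there p) ]
      (λ { (h , here eq) → inj₁ (h , eq) ; (h , there p) → inj₂ (h , p) })
      (numClasses-∪ (λ { (_ , refl) (_ , p) refl → All.lookup e∉ p refl }) (endsAt-darts v e) (sumUp es u))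

  module _ (planar : Planar G) where
    private module R = PlanarRotation planar

    toPlanarMap : PlanarMap (Dart G) n
    toPlanarMap = record
      { rot = σ↣ ; flip = α↣ ; vertex = head G
      ; flip-involutive = α-inv
      ; rot-live = λ _ → α-fpf _
      ; rot-vertex = R.rot-head
      ; rot-transitive = λ _ _ → R.rot-cyclic _ _
      ; spherical = locallySpherical⇒spherical σ↣ α↣ α-inv α-fpf R.euler }
      where
      σ↣ : Dart G ↣ Dart G
      σ↣ = ↔⇒↣ R.rot
      α-inv : ∀ d → α G (α G d) ≡ d
      α-inv (e , b) = cong (e ,_) (not-involutive b)
      α↣ : Dart G ↣ Dart G
      α↣ = involution α-inv
      α-fpf : ∀ d → α G d ≢ d
      α-fpf (e , false) ()
      α-fpf (e , true) ()

    toPlanarMap-live : ∀ d → PlanarMap.Live toPlanarMap d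
    toPlanarMap-live (e , false) ()
    toPlanarMap-live (e , true) ()

    toPlanarMap-valency : ∀ {v k} → degree G v ≡ k → PlanarMap.Valency toPlanarMap v k
    toPlanarMap-valency {v} refl = numClasses-pred (λ {d} h → toPlanarMap-live d , h) proj₂ (degree-darts v)

    toPlanarMap-carries : {H : Multigraph N} → (sub : Subgraph H G) → Carries H toPlanarMap (proj₁ sub)
    toPlanarMap-carries {H = H} (f , _ , g , g-injective , same) = record
      { dart = λ e → g e , side (same e)
      ; dart-live = λ e → toPlanarMap-live _
      ; dart-source = λ e → source e (same e)
      ; dart-target = λ e → target e (same e)
      ; dart-injective = g-injective ∘ cong proj₁
      ; dart-flip-injective = g-injective ∘ cong proj₁ }
      where
      side : ∀ {p q : Fin n × Fin n} → SameEnds p q → Bool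
      side (inj₁ _) = false
      side (inj₂ _) = true
      source : ∀ e (s : SameEnds (f (proj₁ (ends H e)) , f (proj₂ (ends H e))) (ends G (g e))) →
        head G (g e , side s) ≡ f (proj₁ (ends H e))
      source e (inj₁ (p , _)) = sym p
      source e (inj₂ (p , _)) = sym p
      target : ∀ e (s : SameEnds (f (proj₁ (ends H e)) , f (proj₂ (ends H e))) (ends G (g e))) →
        head G (α G (g e , side s)) ≡ f (proj₂ (ends H e))
      target e (inj₁ (_ , q)) = sym q
      target e (inj₂ (_ , q)) = sym q

-- From planar maps back to multigraphs

module ToMultigraph {D : Set} ⦃ fin : Finite D ⦄ (M : PlanarMap D N) (f : Fin n → Fin N)
                    (f-injective : Injective _≡_ _≡_ f)
                    (onto : ∀ {d} → PlanarMap.Live M d → ∃ λ i → f i ≡ PlanarMap.vertex M d) where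
  open PlanarMap M

  private
    reps : List D
    reps = proj₁ (proj₂ (numClasses-exists (reach-isDecEquivalence flip) live?))

    reps-live : All Live reps
    reps-live = proj₁ (proj₂ (proj₂ (proj₂ (numClasses-exists (reach-isDecEquivalence flip) live?))))

    reps-separate : AllPairs (λ x y → ¬ Reach (to flip) x y) reps
    reps-separate = proj₁ (proj₂ (proj₂ (proj₂ (proj₂ (numClasses-exists (reach-isDecEquivalence flip) live?)))))

    reps-cover : ∀ d → Live d → Any (λ r → Reach (to flip) r d) reps
    reps-cover = proj₂ (proj₂ (proj₂ (proj₂ (proj₂ (numClasses-exists (reach-isDecEquivalence flip) live?)))))

    rep-live : ∀ e → Live (lookup reps e)
    rep-live e = All.lookup reps-live (Memₚ.∈-lookup e)

  -- One edge for each flip orbit of live darts. `f` selects the vertices to keep, and `onto`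
  -- ensures that no live dart sits elsewhere: these are the vertices of `H` after the removals, and
  -- all vertices after the replacements.
  graph : Multigraph n
  graph = record
    { m = length reps
    ; ends = λ e → proj₁ (onto (rep-live e)) , proj₁ (onto (flip-live (rep-live e))) }

  ι : Dart graph → D
  ι (e , false) = lookup reps e
  ι (e , true) = to flip (lookup reps e)

  ι-live : ∀ d → Live (ι d)
  ι-live (e , false) = rep-live e
  ι-live (e , true) = flip-live (rep-live e)

  ι-flip : ∀ d → ι (α graph d) ≡ to flip (ι d)
  ι-flip (e , false) = refl
  ι-flip (e , true) = sym (flip-involutive _)

  ι-vertex : ∀ d → f (head graph d) ≡ vertex (ι d)
  ι-vertex (e , false) = proj₂ (onto (rep-live e))
  ι-vertex (e , true) = proj₂ (onto (flip-live (rep-live e)))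

  private
    lookup-related : ∀ {e e′} → Reach (to flip) (lookup reps e) (lookup reps e′) → e ≡ e′
    lookup-related = related⇒sameIndex (reach-isEquivalence flip) reps-separate

  ι-injective : ∀ {d d′} → ι d ≡ ι d′ → d ≡ d′
  ι-injective {e , false} {e′ , false} eq = cong (_, false) (lookup-related (0 , eq))
  ι-injective {e , true} {e′ , true} eq = cong (_, true) (lookup-related (0 , injective flip eq))
  ι-injective {e , false} {e′ , true} eq with lookup-related {e′} {e} (1 , sym eq)
  ... | refl = contradiction (sym eq) (rep-live e)
  ι-injective {e , true} {e′ , false} eq with lookup-related {e} {e′} (1 , eq)
  ... | refl = contradiction eq (rep-live e)

  abstract
    ι-onto : ∀ {d} → Live d → ∃ λ d′ → ι d′ ≡ d
    ι-onto {d} live with reps-cover d live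
    ... | p with reach-involution {α = to flip} flip-involutive (Anyₚ.lookup-index p)
    ...   | inj₁ eq = (Any.index p , false) , eq
    ...   | inj₂ eq = (Any.index p , true) , eq

  private
    σ : Dart graph → Dart graph
    σ d = proj₁ (ι-onto (rot-live (ι-live d)))

    ι-σ : ∀ d → ι (σ d) ≡ to rot (ι d)
    ι-σ d = proj₂ (ι-onto (rot-live (ι-live d)))

    σ↣ : Dart graph ↣ Dart graph
    σ↣ = mk↣ λ {d} {e} eq → ι-injective {d} {e} (injective rot (trans (sym (ι-σ d)) (trans (cong ι {σ d} {σ e} eq) (ι-σ e))))

    module _ {f : D → D} {g : Dart graph → Dart graph} (comm : ∀ d → ι (g d) ≡ f (ι d)) where
      ι-reach : ∀ {d e} → Reach g d e → Reach f (ι d) (ι e)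
      ι-reach = reach-mapOn {g = f} ι (λ _ → ⊤) (λ _ → tt) (λ {d} _ → comm d) tt

      reach-ι : ∀ {d e} → Reach f (ι d) (ι e) → Reach g d e
      reach-ι {d} (k , eq) = k , ι-injective (trans (go k) eq)
        where
        go : ∀ k → ι (iter g k d) ≡ iter f k (ι d)
        go zero = refl
        go (suc k) = trans (comm _) (cong f (go k))

    ι-conn : ∀ {d e} → Conn σ (α graph) d e → Conn (to rot) (to flip) (ι d) (ι e)
    ι-conn here = here
    ι-conn (stepσ {y} c) = subst (Conn _ _ _) (sym (ι-σ y)) (stepσ (ι-conn c))
    ι-conn (stepα {y} c) = subst (Conn _ _ _) (sym (ι-flip y)) (stepα (ι-conn c))

    -- The image of `ι` is the set of live darts, which both permutations preserve, so a path that
    -- starts there lifts step by step.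
    conn-lift : ∀ {d y} → Conn (to rot) (to flip) (ι d) y → ∃ λ e → ι e ≡ y × Conn σ (α graph) d e
    conn-lift here = _ , refl , here
    conn-lift (stepσ c) = let e , eq , c′ = conn-lift c in σ e , trans (ι-σ e) (cong (to rot) eq) , stepσ c′
    conn-lift (stepα c) = let e , eq , c′ = conn-lift c in
      α graph e , trans (ι-flip e) (cong (to flip) eq) , stepα c′

    conn-ι : ∀ {d e} → Conn (to rot) (to flip) (ι d) (ι e) → Conn σ (α graph) d e
    conn-ι {d} {e} c = let e′ , eq , c′ = conn-lift {d} c in subst (Conn _ _ d) (ι-injective {e′} {e} eq) c′

  planar : Planar graph
  planar = record
    { rot = mk↔ₛ′ σ (inverse σ↣) (inverseʳ σ↣) (λ d → injective σ↣ {inverse σ↣ (σ d)} {d} (inverseʳ σ↣ (σ d)))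
    ; rot-head = λ d → f-injective (trans (ι-vertex (σ d)) (trans (cong vertex (ι-σ d))
        (trans (rot-vertex (ι d)) (sym (ι-vertex d)))))
    ; rot-cyclic = λ d e eq → reach-ι ι-σ (rot-transitive (ι-live d) (ι-live e)
        (trans (sym (ι-vertex d)) (trans (cong f eq) (ι-vertex e))))
    ; euler = λ d₀ →
        let V , E , F , v , e , f , eq = spherical⇒locallySpherical rot flip flip-involutive (ι d₀)
              (conn-closed {P = Live} rot-live flip-live (ι-live d₀)) spherical
        in V , E , F , pull ι-σ v , pull ι-flip e ,
           pull (λ d → trans (ι-σ (α graph d)) (cong (to rot) (ι-flip d))) f , eq }
    where
    pull : ∀ {d₀ f g k} → (∀ d → ι (g d) ≡ f (ι d)) →
      NumClasses (Reach f) (Conn (to rot) (to flip) (ι d₀)) k → NumClasses (Reach g) (Conn σ (α graph) d₀) k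
    pull {d₀} comm = numClasses-pullback ι (ι-reach comm) (reach-ι comm) ι-conn conn-ι
      (λ c → let d , eq , _ = conn-lift {d₀} c in d , eq)

  degree-valency : ∀ {i k} → Valency (f i) k → degree graph i ≡ k
  degree-valency {i} nc = numClasses-unique isEquivalence (degree-darts graph i)
    (numClasses-pullback ι (cong ι) ι-injective
      (λ {d} h → ι-live d , trans (sym (ι-vertex d)) (cong f h))
      (λ {d} (_ , h) → f-injective (trans (ι-vertex d) h))
      (λ (live , _) → ι-onto live) nc)

  simple : (∀ {d} → Live d → vertex d ≢ vertex (to flip d)) →
    (∀ {d e} → Live d → Live e → vertex d ≡ vertex e → vertex (to flip d) ≡ vertex (to flip e) → d ≡ e) →
    Simple graph
  simple loopless noparallel =
    (λ e eq → loopless (ι-live (e , false))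
      (trans (sym (ι-vertex (e , false))) (trans (cong f eq) (ι-vertex (e , true))))) ,
    λ { e e′ e≢e′ (inj₁ (p , q)) → e≢e′ (cong proj₁ (ι-injective {e , false} {e′ , false}
          (noparallel (ι-live (e , false)) (ι-live (e′ , false)) (via (e , false) (e′ , false) p)
            (via (e , true) (e′ , true) q))))
      -- The edges run between the same ends in opposite directions, so the dart of `e` is compared
      -- with the reversed dart of `e′`.
      ; e e′ e≢e′ (inj₂ (p , q)) → e≢e′ (cong proj₁ (ι-injective {e , false} {e′ , true}
          (noparallel (ι-live (e , false)) (ι-live (e′ , true)) (via (e , false) (e′ , true) p)
            (trans (via (e , true) (e′ , false) q) (cong vertex (sym (flip-involutive _))))))) }
    where
    via : ∀ d d′ → head graph d ≡ head graph d′ → vertex (ι d) ≡ vertex (ι d′)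
    via d d′ eq = trans (sym (ι-vertex d)) (trans (cong f eq) (ι-vertex d′))

  subgraph : ∀ {k} {H : Multigraph k} (h : Fin k → Fin n) → Injective _≡_ _≡_ h → Carries H M (f ∘ h) →
    Subgraph H graph
  subgraph {H = H} h h-injective carries =
    h , h-injective , (λ e → proj₁ (pre e)) , (λ {e} {e′} → same-edge e e′) , λ e → ends-agree e (pre e) (pre-ι e)
    where
    open Carries carries
    pre : Fin (m H) → Dart graph
    pre e = proj₁ (ι-onto (dart-live e))
    pre-ι : ∀ e → ι (pre e) ≡ dart e
    pre-ι e = proj₂ (ι-onto (dart-live e))

    dart-cases : ∀ {d d′ : Dart graph} → proj₁ d ≡ proj₁ d′ → d ≡ d′ ⊎ d ≡ α graph d′
    dart-cases {_ , false} {_ , false} refl = inj₁ refl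
    dart-cases {_ , false} {_ , true} refl = inj₂ refl
    dart-cases {_ , true} {_ , false} refl = inj₂ refl
    dart-cases {_ , true} {_ , true} refl = inj₁ refl

    same-edge : ∀ e e′ → proj₁ (pre e) ≡ proj₁ (pre e′) → e ≡ e′
    same-edge e e′ eq with dart-cases {pre e} {pre e′} eq
    ... | inj₁ eq′ = dart-injective (trans (sym (pre-ι e)) (trans (cong ι eq′) (pre-ι e′)))
    ... | inj₂ eq′ = dart-flip-injective (trans (sym (pre-ι e)) (trans (cong ι eq′)
          (trans (ι-flip (pre e′)) (cong (to flip) (pre-ι e′)))))

    ends-agree : ∀ e d → ι d ≡ dart e →
      SameEnds (h (proj₁ (ends H e)) , h (proj₂ (ends H e))) (ends graph (proj₁ d))
    ends-agree e d eq = orient d source target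
      where
      source : h (proj₁ (ends H e)) ≡ head graph d
      source = f-injective (trans (sym (dart-source e)) (trans (cong vertex (sym eq)) (sym (ι-vertex d))))
      target : h (proj₂ (ends H e)) ≡ head graph (α graph d)
      target = f-injective (trans (sym (dart-target e)) (trans
        (cong vertex (trans (cong (to flip) (sym eq)) (sym (ι-flip d)))) (sym (ι-vertex (α graph d)))))
      orient : ∀ d → h (proj₁ (ends H e)) ≡ head graph d → h (proj₂ (ends H e)) ≡ head graph (α graph d) →
        SameEnds (h (proj₁ (ends H e)) , h (proj₂ (ends H e))) (ends graph (proj₁ d))
      orient (_ , false) p q = inj₁ (p , q)
      orient (_ , true) p q = inj₂ (p , q)

-- Removing vertices

module Splice ⦃ fin : Finite D ⦄ (α : D ↣ D) (inv : ∀ d → to α (to α d) ≡ d)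
              {a b : D} (a≢b : a ≢ b) (a-live : to α a ≢ a) (b-live : to α b ≢ b) where
  private
    -- In general `α₁` has the 4-cycle `a`, `α a`, `b`, `α b`; splitting off `a` and then `b` leaves
    -- `α a` and `α b` exchanged. If `a` and `b` are the two darts of one edge, `α₁` already fixes
    -- both, and the later transpositions are trivial.
    α₁ α₂ : D ↣ D
    α₁ = transposition a b ↣-∘ α
    α₂ = α₁ ↣-∘ transposition a (to α b)

  -- Joins the edges of a and b into one and discards the darts a and b.
  splice : D ↣ D
  splice = α₂ ↣-∘ transposition b (to α a)

  private
    αa≢αb : to α a ≢ to α b
    αa≢αb = a≢b ∘ injective α

    α₁-αb : to α₁ (to α b) ≡ a
    α₁-αb = trans (cong (transpose a b) (inv b)) (transpose-right a b)

    α₂-αa : to α₂ (to α a) ≡ b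
    α₂-αa = trans (cong (to α₁) (transpose-fix a-live αa≢αb))
      (trans (cong (transpose a b) (inv a)) (transpose-left a b))

    splice-a : to splice a ≡ a
    splice-a = trans (cong (to α₂) (transpose-fix a≢b (a-live ∘ sym)))
      (trans (cong (to α₁) (transpose-left a _)) α₁-αb)

    splice-b : to splice b ≡ b
    splice-b = trans (cong (to α₂) (transpose-left b _)) α₂-αa

    splice-αa : to α a ≢ b → to splice (to α a) ≡ to α b
    splice-αa αa≢b = trans (cong (to α₂) (transpose-right b _))
      (trans (cong (to α₁) (transpose-fix (a≢b ∘ sym) (b-live ∘ sym)))
        (transpose-fix (λ eq → αa≢b (trans (cong (to α) (sym eq)) (inv b))) b-live))

    splice-αb : to α b ≢ a → to splice (to α b) ≡ to α a
    splice-αb αb≢a = trans (cong (to α₂) (transpose-fix b-live (αa≢αb ∘ sym)))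
      (trans (cong (to α₁) (transpose-right a _))
        (transpose-fix a-live (λ eq → αb≢a (trans (cong (to α) (sym eq)) (inv a)))))

    α-swap : ∀ {x y} → to α x ≡ y → x ≡ to α y
    α-swap eq = trans (sym (inv _)) (cong (to α) eq)

    splice-other : ∀ {e} → e ≢ a → e ≢ b → e ≢ to α a → e ≢ to α b → to splice e ≡ to α e
    splice-other e≢a e≢b e≢αa e≢αb = trans (cong (to α₂) (transpose-fix e≢b e≢αa))
      (trans (cong (to α₁) (transpose-fix e≢a e≢αb)) (transpose-fix (e≢αa ∘ α-swap) (e≢αb ∘ α-swap)))

    data View : D → Set where
      is-a  : View a
      is-b  : View b
      is-αa : to α a ≢ b → View (to α a)
      is-αb : to α b ≢ a → View (to α b)
      other : ∀ {e} → e ≢ a → e ≢ b → e ≢ to α a → e ≢ to α b → View e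

    view : ∀ e → View e
    view e with e ≟ a | e ≟ b | e ≟ to α a | e ≟ to α b
    ... | yes refl | _ | _ | _ = is-a
    ... | no _ | yes refl | _ | _ = is-b
    ... | no _ | no e≢b | yes refl | _ = is-αa e≢b
    ... | no e≢a | no _ | no _ | yes refl = is-αb e≢a
    ... | no e≢a | no e≢b | no e≢αa | no e≢αb = other e≢a e≢b e≢αa e≢αb

  splice-agree : ∀ {e} → e ≢ a → e ≢ b → to α e ≢ a → to α e ≢ b → to splice e ≡ to α e
  splice-agree e≢a e≢b αe≢a αe≢b = splice-other e≢a e≢b
    (λ eq → αe≢a (trans (cong (to α) eq) (inv a))) (λ eq → αe≢b (trans (cong (to α) eq) (inv b)))

  splice-involutive : ∀ e → to splice (to splice e) ≡ e
  splice-involutive e with view e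
  ... | is-a = trans (cong (to splice) splice-a) splice-a
  ... | is-b = trans (cong (to splice) splice-b) splice-b
  ... | is-αa αa≢b = trans (cong (to splice) (splice-αa αa≢b)) (splice-αb (λ eq → αa≢b (sym (α-swap eq))))
  ... | is-αb αb≢a = trans (cong (to splice) (splice-αb αb≢a)) (splice-αa (λ eq → αb≢a (sym (α-swap eq))))
  ... | other e≢a e≢b e≢αa e≢αb = trans (cong (to splice) (splice-other e≢a e≢b e≢αa e≢αb))
          (trans (splice-other (e≢αa ∘ α-swap) (e≢αb ∘ α-swap) (e≢a ∘ injective α) (e≢b ∘ injective α)) (inv e))

  splice-live⁻ : ∀ {e} → to splice e ≢ e → to α e ≢ e × e ≢ a × e ≢ b
  splice-live⁻ {e} live with view e
  ... | is-a = contradiction splice-a live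
  ... | is-b = contradiction splice-b live
  ... | is-αa αa≢b = (a-live ∘ injective α) , a-live , αa≢b
  ... | is-αb αb≢a = (b-live ∘ injective α) , αb≢a , b-live
  ... | other e≢a e≢b e≢αa e≢αb =
          (λ eq → live (trans (splice-other e≢a e≢b e≢αa e≢αb) eq)) , e≢a , e≢b

  splice-live⁺ : ∀ {e} → to α e ≢ e → e ≢ a → e ≢ b → to splice e ≢ e
  splice-live⁺ {e} live e≢a e≢b eq with view e
  ... | is-a = e≢a refl
  ... | is-b = e≢b refl
  ... | is-αa αa≢b = αa≢αb (sym (trans (sym (splice-αa αa≢b)) eq))
  ... | is-αb αb≢a = αa≢αb (trans (sym (splice-αb αb≢a)) eq)
  ... | other _ _ e≢αa e≢αb = live (trans (sym (splice-other e≢a e≢b e≢αa e≢αb)) eq)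

  -- The passage to `α₁` goes with the same transposition in the rotation and keeps the faces. The
  -- two remaining steps split the flip alone and keep the new rotation.
  splice-spherical : ∀ σ → Reach (to σ) a b → Global.Spherical D σ α →
    Global.Spherical D (σ ↣-∘ transposition a b) splice
  splice-spherical σ ab sph = splitOff α₂ α₂-αa (splitOff α₁ α₁-αb
    (splits-spherical _ _ (split-keepingφ σ α a≢b tt tt (inv a) (inv b) tt tt ab) sph))
    where
    open Global D
    σ′ = σ ↣-∘ transposition a b

    splitOff : ∀ β {x y} → to β y ≡ x → Spherical σ′ β → Spherical σ′ (β ↣-∘ transposition x y)
    splitOff β {x} {y} βy≡x sph with x ≟ y
    -- This occurs when `a` and `b` belong to one edge: the dart is a fixed point already.
    ... | yes refl = spherical-cong {σ′} {β} {σ′} {β ↣-∘ transposition x x}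
            (λ _ → refl) (λ d → cong (to β) (sym (transpose-id x d))) sph
    ... | no x≢y = splits-spherical _ _ (split-keepingσ σ′ β x≢y tt tt (reach-sym β (1 , βy≡x))) sph

record FourCycle ⦃ _ : Finite D ⦄ (M : PlanarMap D N) (v : Fin N) : Set where
  open PlanarMap M
  field
    a : D
  b : D
  b = to rot a
  c : D
  c = to rot b
  d : D
  d = to rot c
  field
    returns  : to rot d ≡ a
    distinct : AllPairs _≢_ (a ∷ b ∷ c ∷ d ∷ [])
    located  : All (At v) (a ∷ b ∷ c ∷ d ∷ [])
    exhaust  : ∀ {e} → At v e → e ∈ a ∷ b ∷ c ∷ d ∷ []

-- A list that contains `x` and is closed under the rotation contains every dart at `v`, hence has
-- at least four entries; this rules out an earlier return to `x`. No return at the fourth step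
-- would produce five different darts at `v`.
fourCycle : ⦃ _ : Finite D ⦄ → (M : PlanarMap D N) → ∀ {v} → PlanarMap.Valency M v 4 → FourCycle M v
fourCycle {D = D} M {v} (x ∷ L , length-L , atx ∷ inP , ap , cover) = record
  { a = x
  ; returns = x⁴≡x
  ; distinct = distinct₄
  ; located = located₄
  ; exhaust = within {x ∷ f x ∷ f (f x) ∷ f (f (f x)) ∷ []} (here refl)
      λ { (here refl) → there (here refl) ; (there (here refl)) → there (there (here refl))
        ; (there (there (here refl))) → there (there (there (here refl)))
        ; (there (there (there (here refl)))) → here x⁴≡x } }
  where
  open PlanarMap M
  f = to rot

  at-rot : ∀ {e} → At v e → At v (f e)
  at-rot (live , eq) = rot-live live , trans (rot-vertex _) eq

  within : ∀ {K} → x ∈ K → (∀ {e} → e ∈ K → f e ∈ K) → ∀ {e} → At v e → e ∈ K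
  within {K} x∈ closed (live , eq) = reach-closed {P = _∈ K} closed x∈
    (rot-transitive (proj₁ atx) live (trans (proj₂ atx) (sym eq)))

  long : ∀ {K} → x ∈ K → (∀ {e} → e ∈ K → f e ∈ K) → 4 ≤ length K
  long {K} x∈ closed = subst (_≤ length K) length-L (independent≤covering isEquivalence ap
    (All.map (Any.map sym ∘ within x∈ closed) (atx ∷ inP)))

  x≢fx : x ≢ f x
  x≢fx eq = contradiction (long {x ∷ []} (here refl) λ { (here refl) → here (sym eq) })
    λ { (s≤s ()) }

  x≢f²x : x ≢ f (f x)
  x≢f²x eq = contradiction (long {x ∷ f x ∷ []} (here refl)
    λ { (here refl) → there (here refl) ; (there (here refl)) → here (sym eq) })
    λ { (s≤s (s≤s ())) }

  x≢f³x : x ≢ f (f (f x))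
  x≢f³x eq = contradiction (long {x ∷ f x ∷ f (f x) ∷ []} (here refl)
    λ { (here refl) → there (here refl) ; (there (here refl)) → there (there (here refl))
      ; (there (there (here refl))) → here (sym eq) })
    λ { (s≤s (s≤s (s≤s ()))) }

  distinct₄ : AllPairs _≢_ (x ∷ f x ∷ f (f x) ∷ f (f (f x)) ∷ [])
  distinct₄ = (x≢fx ∷ x≢f²x ∷ x≢f³x ∷ [])
    ∷ (x≢fx ∘ injective rot ∷ x≢f²x ∘ injective rot ∷ [])
    ∷ (x≢fx ∘ injective rot ∘ injective rot ∷ []) ∷ [] ∷ []

  located₄ : All (At v) (x ∷ f x ∷ f (f x) ∷ f (f (f x)) ∷ [])
  located₄ = atx ∷ at-rot atx ∷ at-rot (at-rot atx) ∷ at-rot (at-rot (at-rot atx)) ∷ []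

  x⁴≡x : f (f (f (f x))) ≡ x
  x⁴≡x = decidable-stable (f (f (f (f x))) ≟ x) λ x⁴≢x →
    contradiction (subst (5 ≤_) length-L (independent≤covering isEquivalence
      (((x⁴≢x ∘ sym) ∷ x≢fx ∷ x≢f²x ∷ x≢f³x ∷ []) ∷′ distinct₄)
      (All.map (cover _) (at-rot (at-rot (at-rot (at-rot atx))) ∷ located₄))))
      λ { (s≤s (s≤s (s≤s (s≤s ())))) }
    where
    _∷′_ : All (x ≢_) (f (f (f (f x))) ∷ f x ∷ f (f x) ∷ f (f (f x)) ∷ []) →
      AllPairs _≢_ (x ∷ f x ∷ f (f x) ∷ f (f (f x)) ∷ []) →
      AllPairs _≢_ (f (f (f (f x))) ∷ x ∷ f x ∷ f (f x) ∷ f (f (f x)) ∷ [])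
    (n₄ ∷ _) ∷′ ap = ((n₄ ∘ sym) ∷ x≢f³x ∘ sym ∘ injective rot ∷ x≢f²x ∘ sym ∘ injective rot ∘ injective rot
      ∷ x≢fx ∘ sym ∘ injective rot ∘ injective rot ∘ injective rot ∷ []) ∷ ap

-- Both maps live on the same darts and vertices; removing means discarding darts. `flip-≡` asks for
-- both ends to be kept because an edge with a removed end is rerouted.
record Removal {D : Set} ⦃ fin : Finite D ⦄ (M M′ : PlanarMap D N) (Removed : Fin N → Set) : Set where
  private
    module M = PlanarMap M
    module M′ = PlanarMap M′
  field
    vertex-≡  : ∀ e → M′.vertex e ≡ M.vertex e
    live⁻     : ∀ {e} → M′.Live e → M.Live e × ¬ Removed (M.vertex e)
    live⁺     : ∀ {e} → M.Live e → ¬ Removed (M.vertex e) → M′.Live e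
    flip-≡    : ∀ {e} → ¬ Removed (M.vertex e) → ¬ Removed (M.vertex (to M.flip e)) →
                to M′.flip e ≡ to M.flip e

removeVertex : ⦃ _ : Finite D ⦄ → (M : PlanarMap D N) → ∀ {v} → PlanarMap.Valency M v 4 →
  ∃ λ M′ → Removal M M′ (_≡ v)
removeVertex {D = D} M {v} valency with fourCycle M valency
... | record { a = a ; distinct = (a≢b ∷ a≢c ∷ a≢d ∷ []) ∷ (b≢c ∷ b≢d ∷ []) ∷ (c≢d ∷ []) ∷ [] ∷ []
             ; located = (a-live , a-v) ∷ (b-live , b-v) ∷ (c-live , c-v) ∷ (d-live , d-v) ∷ []
             ; exhaust = exhaust } =
  record
    { rot = σ₃
    ; flip = S₂.splice
    ; vertex = vertex
    ; flip-involutive = S₂.splice-involutive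
    ; rot-live = λ live′ → let live , e≢v = live-out live′ in
        subst (λ e → to S₂.splice e ≢ e) (σ-≡ e≢v) (live-in (rot-live live) (e≢v ∘ trans (sym (rot-vertex _))))
    ; rot-vertex = σ₃-vertex
    ; rot-transitive = λ live live′ eq → let liveₑ , e≢v = live-out live in
        reach-mapOn {f = to rot} {g = to σ₃} id (λ e → vertex e ≢ v) (λ e≢v → e≢v ∘ trans (sym (rot-vertex _))) σ-≡ e≢v
          (rot-transitive liveₑ (proj₁ (live-out live′)) eq)
    ; spherical = S₂.splice-spherical σ₂ (1 , σ₂c≡d) (S₁.splice-spherical σ₁ (1 , σ₁a≡b)
        (splits-spherical _ _ (split-keepingα rot flip b≢d tt tt (flip-involutive b) (flip-involutive d)
          tt tt (2 , refl)) spherical)) } ,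
  record
    { vertex-≡ = λ _ → refl
    ; live⁻ = live-out
    ; live⁺ = live-in
    ; flip-≡ = λ e≢v fe≢v → trans
        (S₂.splice-agree (away e≢v c-v) (away e≢v d-v)
          (away fe≢v c-v ∘ trans (sym (S₁-agree e≢v fe≢v))) (away fe≢v d-v ∘ trans (sym (S₁-agree e≢v fe≢v))))
        (S₁-agree e≢v fe≢v) }
  where
  open PlanarMap M
  open Global D
  b c d : D
  b = to rot a
  c = to rot b
  d = to rot c

  away : ∀ {e x} → vertex e ≢ v → vertex x ≡ v → e ≢ x
  away e≢v x-v refl = e≢v x-v

  -- `σ₁` divides the cycle of `a`, `b`, `c`, `d` into one of `a`, `b` and one of `c`, `d`, keeping
  -- the flip. `σ₂` and `σ₃` accompany the two splices and dissolve these cycles into fixed points.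
  σ₁ σ₂ σ₃ : D ↣ D
  σ₁ = rot ↣-∘ transposition b d
  σ₂ = σ₁ ↣-∘ transposition a b
  σ₃ = σ₂ ↣-∘ transposition c d

  σ₁a≡b : to σ₁ a ≡ b
  σ₁a≡b = cong (to rot) (transpose-fix a≢b a≢d)

  σ₂c≡d : to σ₂ c ≡ d
  σ₂c≡d = trans (cong (to σ₁) (transpose-fix (a≢c ∘ sym) (b≢c ∘ sym)))
    (cong (to rot) (transpose-fix (b≢c ∘ sym) c≢d))

  module S₁ = Splice flip flip-involutive a≢b a-live b-live
  -- Loops at `v` are no exception: the first splice discards `a` and `b` only, so `c` and `d` are
  -- still live, even if they have become the two darts of one edge.
  module S₂ = Splice S₁.splice S₁.splice-involutive c≢d
    (S₁.splice-live⁺ c-live (a≢c ∘ sym) (b≢c ∘ sym)) (S₁.splice-live⁺ d-live (a≢d ∘ sym) (b≢d ∘ sym))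

  S₁-agree : ∀ {e} → vertex e ≢ v → vertex (to flip e) ≢ v → to S₁.splice e ≡ to flip e
  S₁-agree e≢v fe≢v = S₁.splice-agree (away e≢v a-v) (away e≢v b-v) (away fe≢v a-v) (away fe≢v b-v)

  σ-≡ : ∀ {e} → vertex e ≢ v → to rot e ≡ to σ₃ e
  σ-≡ e≢v = sym (trans (cong (to σ₂) (transpose-fix (away e≢v c-v) (away e≢v d-v)))
    (trans (cong (to σ₁) (transpose-fix (away e≢v a-v) (away e≢v b-v)))
      (cong (to rot) (transpose-fix (away e≢v b-v) (away e≢v d-v)))))

  transpose-vertex : ∀ {x y} → vertex x ≡ v → vertex y ≡ v → ∀ e → vertex (transpose x y e) ≡ vertex e
  transpose-vertex x-v y-v = transpose-elim (λ d e → vertex e ≡ vertex d)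
    (trans y-v (sym x-v)) (trans x-v (sym y-v)) (λ _ _ → refl)

  σ₃-vertex : ∀ e → vertex (to σ₃ e) ≡ vertex e
  σ₃-vertex e = trans (rot-vertex _) (trans (transpose-vertex b-v d-v _)
    (trans (transpose-vertex a-v b-v _) (transpose-vertex c-v d-v e)))

  live-out : ∀ {e} → to S₂.splice e ≢ e → Live e × vertex e ≢ v
  live-out live″ =
    let live′ , e≢c , e≢d = S₂.splice-live⁻ live″
        live , e≢a , e≢b = S₁.splice-live⁻ live′
    in live , λ e-v → case exhaust (live , e-v) of λ
      { (here eq) → e≢a eq ; (there (here eq)) → e≢b eq ; (there (there (here eq))) → e≢c eq
      ; (there (there (there (here eq)))) → e≢d eq }

  live-in : ∀ {e} → Live e → vertex e ≢ v → to S₂.splice e ≢ e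
  live-in live e≢v = S₂.splice-live⁺ (S₁.splice-live⁺ live (away e≢v a-v) (away e≢v b-v)) (away e≢v c-v) (away e≢v d-v)

removal-valency : ⦃ _ : Finite D ⦄ → {M M′ : PlanarMap D N} {Removed : Fin N → Set} → Removal M M′ Removed →
  ∀ {w k} → ¬ Removed w → PlanarMap.Valency M w k → PlanarMap.Valency M′ w k
removal-valency {Removed = Removed} r ¬rw = numClasses-pred
  (λ {e} (live , eq) → live⁺ live (λ rm → ¬rw (subst Removed eq rm)) , trans (vertex-≡ e) eq)
  (λ {e} (live , eq) → proj₁ (live⁻ live) , trans (sym (vertex-≡ e)) eq)
  where open Removal r

-- Each removal preserves the valency of the other vertices; as `L` has no repetition, those still
-- waiting keep valency 4.
removeVertices : ⦃ _ : Finite D ⦄ → (M : PlanarMap D N) → ∀ L → Unique L →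
  All (λ v → PlanarMap.Valency M v 4) L → ∃ λ M′ → Removal M M′ (_∈ L)
removeVertices M [] _ _ = M , record
  { vertex-≡ = λ _ → refl ; live⁻ = λ live → live , λ () ; live⁺ = λ live _ → live ; flip-≡ = λ _ _ → refl }
removeVertices M (v ∷ L) (v∉ ∷ unique) (val ∷ vals) =
  let M₁ , r₁ = removeVertex M val
      M₂ , r₂ = removeVertices M₁ L unique
        (All.zipWith (λ (v≢w , valw) → removal-valency r₁ (v≢w ∘ sym) valw) (v∉ , vals))
      module R₁ = Removal r₁
      module R₂ = Removal r₂
      rest : ∀ {e} → PlanarMap.vertex M e ∉ v ∷ L → PlanarMap.vertex M₁ e ∉ L
      rest {e} e∉ = e∉ ∘ there ∘ subst (_∈ L) (R₁.vertex-≡ e)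
  in M₂ , record
    { vertex-≡ = λ e → trans (R₂.vertex-≡ e) (R₁.vertex-≡ e)
    ; live⁻ = λ {e} live₂ →
        let live₁ , e∉L = R₂.live⁻ live₂
            live , e≢v = R₁.live⁻ live₁
        in live , λ { (here eq) → e≢v eq ; (there e∈) → e∉L (subst (_∈ L) (sym (R₁.vertex-≡ e)) e∈) }
    ; live⁺ = λ live e∉ → R₂.live⁺ (R₁.live⁺ live (e∉ ∘ here)) (rest e∉)
    ; flip-≡ = λ {e} e∉ fe∉ →
        let eq₁ = R₁.flip-≡ (e∉ ∘ here) (fe∉ ∘ here)
        in trans (R₂.flip-≡ (rest e∉) (subst (λ x → PlanarMap.vertex M₁ x ∉ L) (sym eq₁) (rest fe∉))) eq₁ }

-- All vertices outside the image of `f` are removed, so `f` identifies the vertices of `H` with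
-- those that remain. An edge of `H` has both ends in the image, hence keeps its flip throughout.
restrictToSubgraph : ∀ {N} (H : Multigraph n) (G : Multigraph N) → Regular 4 G → Planar G → Subgraph H G →
  Σ (Multigraph n) λ G′ → Regular 4 G′ × Planar G′ × Subgraph H G′
restrictToSubgraph {n} {N} H G regular planar sub@(f , f-injective , _) =
  T.graph ,
  (λ i → T.degree-valency (removal-valency r (kept i) (toPlanarMap-valency G planar (regular (f i))))) ,
  T.planar , T.subgraph id id carries′
  where
  M = toPlanarMap G planar

  outside? : Decidable (λ v → ¬ ∃ λ i → f i ≡ v)
  outside? v = ¬? (any-dec λ i → f i ≟ v)

  outside : List (Fin N)
  outside = filter outside? (allFin N)

  kept : ∀ i → f i ∉ outside
  kept i fi∈ = proj₂ (Memₚ.∈-filter⁻ outside? {xs = allFin N} fi∈) (i , refl)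

  removed : ∃ λ M′ → Removal M M′ (_∈ outside)
  removed = removeVertices M outside (Uniqueₚ.filter⁺ outside? (Uniqueₚ.allFin⁺ N))
    (All.universal (λ v → toPlanarMap-valency G planar (regular v)) outside)

  M′ = proj₁ removed
  r = proj₂ removed
  open Removal r

  onto : ∀ {d} → PlanarMap.Live M′ d → ∃ λ i → f i ≡ PlanarMap.vertex M′ d
  onto {d} live =
    let i , eq = decidable-stable (any-dec λ i → f i ≟ PlanarMap.vertex M d)
          (λ no-i → proj₂ (live⁻ live) (Memₚ.∈-filter⁺ outside? (complete _) no-i))
    in i , trans eq (sym (vertex-≡ d))

  open Carries (toPlanarMap-carries G planar sub)

  source-kept : ∀ e → PlanarMap.vertex M (dart e) ∉ outside
  source-kept e = kept _ ∘ subst (_∈ outside) (dart-source e)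

  target-kept : ∀ e → PlanarMap.vertex M (α G (dart e)) ∉ outside
  target-kept e = kept _ ∘ subst (_∈ outside) (dart-target e)

  flip-kept : ∀ e → Injection.to (PlanarMap.flip M′) (dart e) ≡ α G (dart e)
  flip-kept e = flip-≡ (source-kept e) (target-kept e)

  carries′ : Carries H M′ f
  carries′ = record
    { dart = dart
    ; dart-live = λ e → live⁺ (dart-live e) (source-kept e)
    ; dart-source = λ e → trans (vertex-≡ _) (dart-source e)
    ; dart-target = λ e → trans (vertex-≡ _) (trans (cong (PlanarMap.vertex M) (flip-kept e)) (dart-target e))
    ; dart-injective = dart-injective
    ; dart-flip-injective = λ {_} {e′} eq → dart-flip-injective (trans eq (flip-kept e′)) }

  module T = ToMultigraph M′ f f-injective onto

-- Connected sums

module _ ⦃ fin : Finite D ⦄ where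
  open Global D

  -- Across different components the transposition joins orbits of `α` as well as of the faces. The
  -- left side drops by 2, and so does the right side, since two components become one.
  join-spherical : ∀ (σ α : D ↣ D) {x y} → ¬ Conn (to σ) (to α) x y → Spherical σ α →
    Spherical σ (α ↣-∘ transposition x y)
  join-spherical σ α {x} {y} ¬xy sph = ℕₚ.+-cancelˡ-≡ 2 _ _ (begin
    2 + eulerSum σ α′ ≡⟨ shift₁ (orbits σ) (orbits α′) (orbits (σ ↣-∘ α′)) ⟩
    orbits σ + suc (orbits α′) + suc (orbits (σ ↣-∘ α′))
      ≡⟨ cong₂ (λ a f → orbits σ + a + f)
           (orbits-joined α α′ x≢y tt tt (λ _ → refl) (¬xy ∘ reach⇒connα))
           (orbits-joined (σ ↣-∘ α) (σ ↣-∘ α′) x≢y tt tt (λ _ → refl) (¬xy ∘ reach⇒connφ)) ⟨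
    eulerSum σ α ≡⟨ sph ⟩
    size + (components σ α + components σ α) ≡⟨ cong (λ c → size + (c + c)) components-joined ⟩
    size + (suc (components σ α′) + suc (components σ α′)) ≡⟨ shift₂ size (components σ α′) ⟩
    2 + (size + (components σ α′ + components σ α′)) ∎)
    where
    open ≡-Reasoning
    α′ = α ↣-∘ transposition x y

    shift₁ : ∀ a b c → 2 + (a + b + c) ≡ a + suc b + suc c
    shift₁ = solve-∀
    shift₂ : ∀ n c → n + (suc c + suc c) ≡ 2 + (n + (c + c))
    shift₂ = solve-∀

    x≢y : x ≢ y
    x≢y refl = ¬xy here

    C-equiv = conn-isEquivalence σ α
    C′-equiv = conn-isEquivalence σ α′
    M-equiv = merge-isEquivalence C-equiv x y

    C′-xy : Conn (to σ) (to α′) x y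
    C′-xy = reach⇒connα (orbits-join α x≢y (¬xy ∘ reach⇒connα))

    components-joined : components σ α ≡ suc (components σ α′)
    components-joined = #-merge (conn-isDecEquivalence σ α) (conn-isDecEquivalence σ α′) tt tt ¬xy
      (merge-fold C-equiv C′-equiv (conn-fold C′-equiv (λ _ → stepσ here)
        (λ d → conn-trans (transpose-related C′-equiv C′-xy d)
          (subst (Conn _ _ _) (cong (to α) (transpose-involutive x y d)) (stepα here)))) C′-xy)
      (conn-fold M-equiv (λ _ → inj₁ (stepσ here))
        (λ d → IsEquivalence.trans M-equiv
          (transpose-related M-equiv (inj₂ (inj₁ (here , here))) d) (inj₁ (stepα here))))

numClasses-⊎ : ∀ {A B : Set} {R : Rel A 0ℓ} {S : Rel B 0ℓ} {T : Rel (A ⊎ B) 0ℓ} {j k} →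
  (∀ {x y} → R x y → T (inj₁ x) (inj₁ y)) → (∀ {x y} → T (inj₁ x) (inj₁ y) → R x y) →
  (∀ {x y} → S x y → T (inj₂ x) (inj₂ y)) → (∀ {x y} → T (inj₂ x) (inj₂ y) → S x y) →
  (∀ {x y} → ¬ T (inj₁ x) (inj₂ y)) →
  NumClasses R (λ _ → ⊤) j → NumClasses S (λ _ → ⊤) k → NumClasses T (λ _ → ⊤) (j + k)
numClasses-⊎ R⇒T T⇒R S⇒T T⇒S sep (L , refl , _ , ap , cover) (L′ , refl , _ , ap′ , cover′) =
  map inj₁ L ++ map inj₂ L′ ,
  trans (Listₚ.length-++ (map inj₁ L)) (cong₂ _+_ (Listₚ.length-map inj₁ L) (Listₚ.length-map inj₂ L′)) ,
  All.universal _ _ ,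
  AllPairsₚ.++⁺ (AllPairsₚ.map⁺ (AllPairs.map (_∘ T⇒R) ap)) (AllPairsₚ.map⁺ (AllPairs.map (_∘ T⇒S) ap′))
    (Allₚ.map⁺ (All.universal (λ x → Allₚ.map⁺ (All.universal (λ y → sep) L′)) L)) ,
  λ { (inj₁ x) _ → Anyₚ.++⁺ˡ (Anyₚ.map⁺ (Any.map R⇒T (cover x tt)))
    ; (inj₂ y) _ → Anyₚ.++⁺ʳ (map inj₁ L) (Anyₚ.map⁺ (Any.map S⇒T (cover′ y tt))) }

_⊎↣_ : (D ↣ D) → (X ↣ X) → ((D ⊎ X) ↣ (D ⊎ X))
f ⊎↣ g = mk↣ {to = ⊎.map (to f) (to g)} λ
  { {inj₁ x} {inj₁ y} eq → cong inj₁ (injective f (⊎ₚ.inj₁-injective eq))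
  ; {inj₂ x} {inj₂ y} eq → cong inj₂ (injective g (⊎ₚ.inj₂-injective eq)) }

module _ {f : D → D} {g : X → X} where

  reach-⊎₁ : ∀ {x y} → Reach (⊎.map f g) (inj₁ x) y → ∃ λ z → y ≡ inj₁ z × Reach f x z
  reach-⊎₁ = reach-closed {P = λ y → ∃ λ z → y ≡ inj₁ z × Reach f _ z}
    (λ { (z , refl , r) → f z , refl , reach-trans r (reach-step f z) }) (_ , refl , reach-refl)

  reach-⊎₂ : ∀ {x y} → Reach (⊎.map f g) (inj₂ x) y → ∃ λ z → y ≡ inj₂ z × Reach g x z
  reach-⊎₂ = reach-closed {P = λ y → ∃ λ z → y ≡ inj₂ z × Reach g _ z}
    (λ { (z , refl , r) → g z , refl , reach-trans r (reach-step g z) }) (_ , refl , reach-refl)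

  reach-inj₁ : ∀ {x y} → Reach f x y → Reach (⊎.map f g) (inj₁ x) (inj₁ y)
  reach-inj₁ = reach-mapOn {f = f} {g = ⊎.map f g} inj₁ (λ _ → ⊤) (λ _ → tt) (λ _ → refl) tt

  reach-inj₂ : ∀ {x y} → Reach g x y → Reach (⊎.map f g) (inj₂ x) (inj₂ y)
  reach-inj₂ = reach-mapOn {f = g} {g = ⊎.map f g} inj₂ (λ _ → ⊤) (λ _ → tt) (λ _ → refl) tt

module _ {σ α : D → D} {ρ β : X → X} where

  conn-⊎₁ : ∀ {x y} → Conn (⊎.map σ ρ) (⊎.map α β) (inj₁ x) y → ∃ λ z → y ≡ inj₁ z × Conn σ α x z
  conn-⊎₁ = conn-closed {P = λ y → ∃ λ z → y ≡ inj₁ z × Conn σ α _ z}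
    (λ { (_ , refl , c) → _ , refl , stepσ c }) (λ { (_ , refl , c) → _ , refl , stepα c }) (_ , refl , here)

  conn-⊎₂ : ∀ {x y} → Conn (⊎.map σ ρ) (⊎.map α β) (inj₂ x) y → ∃ λ z → y ≡ inj₂ z × Conn ρ β x z
  conn-⊎₂ = conn-closed {P = λ y → ∃ λ z → y ≡ inj₂ z × Conn ρ β _ z}
    (λ { (_ , refl , c) → _ , refl , stepσ c }) (λ { (_ , refl , c) → _ , refl , stepα c }) (_ , refl , here)

  conn-inj₁ : ∀ {x y} → Conn σ α x y → Conn (⊎.map σ ρ) (⊎.map α β) (inj₁ x) (inj₁ y)
  conn-inj₁ here = here
  conn-inj₁ (stepσ c) = stepσ (conn-inj₁ c)
  conn-inj₁ (stepα c) = stepα (conn-inj₁ c)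

  conn-inj₂ : ∀ {x y} → Conn ρ β x y → Conn (⊎.map σ ρ) (⊎.map α β) (inj₂ x) (inj₂ y)
  conn-inj₂ here = here
  conn-inj₂ (stepσ c) = stepσ (conn-inj₂ c)
  conn-inj₂ (stepα c) = stepα (conn-inj₂ c)

module _ ⦃ finD : Finite D ⦄ ⦃ finX : Finite X ⦄ where
  private
    module GD = Global D
    module GX = Global X
    module G = Global (D ⊎ X)

  orbits-⊎ : ∀ (f : D ↣ D) (g : X ↣ X) (h : (D ⊎ X) ↣ (D ⊎ X)) → (∀ d → to h d ≡ ⊎.map (to f) (to g) d) →
    G.orbits h ≡ GD.orbits f + GX.orbits g
  orbits-⊎ f g h h≡ = trans (G.orbits-cong h (f ⊎↣ g) h≡)
    (numClasses-unique (reach-isEquivalence (f ⊎↣ g)) (G.#-spec _)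
      (numClasses-⊎ reach-inj₁ (λ r → case reach-⊎₁ r of λ { (_ , refl , r′) → r′ })
        reach-inj₂ (λ r → case reach-⊎₂ r of λ { (_ , refl , r′) → r′ })
        (λ r → case reach-⊎₁ r of λ { (_ , () , _) })
        (GD.#-spec (reach-isDecEquivalence f)) (GX.#-spec (reach-isDecEquivalence g))))

  ⊎-spherical : ∀ σ α ρ β → GD.Spherical σ α → GX.Spherical ρ β → G.Spherical (σ ⊎↣ ρ) (α ⊎↣ β)
  ⊎-spherical σ α ρ β sph sph′ = begin
    G.eulerSum (σ ⊎↣ ρ) (α ⊎↣ β)
      ≡⟨ cong₂ _+_ (cong₂ _+_ (orbits-⊎ σ ρ _ (λ _ → refl)) (orbits-⊎ α β _ (λ _ → refl)))
           (orbits-⊎ (σ ↣-∘ α) (ρ ↣-∘ β) _ (λ { (inj₁ _) → refl ; (inj₂ _) → refl })) ⟩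
    (GD.orbits σ + GX.orbits ρ) + (GD.orbits α + GX.orbits β) + (GD.orbits (σ ↣-∘ α) + GX.orbits (ρ ↣-∘ β))
      ≡⟨ regroup₁ (GD.orbits σ) (GX.orbits ρ) (GD.orbits α) (GX.orbits β) _ _ ⟩
    GD.eulerSum σ α + GX.eulerSum ρ β ≡⟨ cong₂ _+_ sph sph′ ⟩
    (GD.size + (GD.components σ α + GD.components σ α)) + (GX.size + (GX.components ρ β + GX.components ρ β))
      ≡⟨ regroup₂ GD.size GX.size (GD.components σ α) (GX.components ρ β) ⟩
    (GD.size + GX.size) + ((GD.components σ α + GX.components ρ β) + (GD.components σ α + GX.components ρ β))
      ≡⟨ cong₂ (λ n c → n + (c + c)) size-⊎ components-⊎ ⟨
    G.size + (G.components (σ ⊎↣ ρ) (α ⊎↣ β) + G.components (σ ⊎↣ ρ) (α ⊎↣ β)) ∎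
    where
    open ≡-Reasoning
    regroup₁ : ∀ a b c d e f → (a + b) + (c + d) + (e + f) ≡ (a + c + e) + (b + d + f)
    regroup₁ = solve-∀
    regroup₂ : ∀ n m c d → (n + (c + c)) + (m + (d + d)) ≡ (n + m) + ((c + d) + (c + d))
    regroup₂ = solve-∀

    size-⊎ : G.size ≡ GD.size + GX.size
    size-⊎ = numClasses-unique isEquivalence (G.#-spec ≡-isDecEquivalence)
      (numClasses-⊎ (cong inj₁) ⊎ₚ.inj₁-injective (cong inj₂) ⊎ₚ.inj₂-injective (λ ())
        (GD.#-spec ≡-isDecEquivalence) (GX.#-spec ≡-isDecEquivalence))

    components-⊎ : G.components (σ ⊎↣ ρ) (α ⊎↣ β) ≡ GD.components σ α + GX.components ρ β
    components-⊎ = numClasses-unique (conn-isEquivalence (σ ⊎↣ ρ) (α ⊎↣ β)) (G.#-spec _)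
      (numClasses-⊎ conn-inj₁ (λ r → case conn-⊎₁ r of λ { (_ , refl , r′) → r′ })
        conn-inj₂ (λ r → case conn-⊎₂ r of λ { (_ , refl , r′) → r′ })
        (λ r → case conn-⊎₁ r of λ { (_ , () , _) })
        (GD.#-spec (conn-isDecEquivalence σ α)) (GX.#-spec (conn-isDecEquivalence ρ β)))

  -- Exchanging the darts α a and x reconnects the edges {a, α a} and {x, β x} of
  -- two maps as {a, x} and {α a, β x}, which forms the connected sum along them.
  module ConnectedSum (σ α : D ↣ D) (ρ β : X ↣ X)
                      (α-inv : ∀ d → to α (to α d) ≡ d) (β-inv : ∀ d → to β (to β d) ≡ d)
                      (a : D) (x : X) where
    private
      a′ x′ : D ⊎ X
      a′ = inj₁ (to α a)
      x′ = inj₂ x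

    sumRot sumFlip : (D ⊎ X) ↣ (D ⊎ X)
    sumRot = σ ⊎↣ ρ
    sumFlip = transposition a′ x′ ↣-∘ ((α ⊎↣ β) ↣-∘ transposition a′ x′)

    -- Joining the two components by `γ` turns the two edges into the 4-cycle `a`, `α a`, `β x`,
    -- `x`. The second copy of the transposition, moved to the right of `γ`, exchanges `a` and
    -- `β x`, which lie two steps apart, and splits this cycle into the new edges.
    sum-spherical : (to α a ≢ a) → (to β x ≢ x) → GD.Spherical σ α → GX.Spherical ρ β → G.Spherical sumRot sumFlip
    sum-spherical αa≢a βx≢x sph sph′ =
      G.spherical-cong {sumRot} {γ ↣-∘ transposition (inj₁ a) (inj₂ (to β x))} {sumRot} {sumFlip} (λ _ → refl) γ-conjugate
      (G.splits-spherical _ _ (G.split-keepingσ sumRot γ (λ ()) tt tt (2 , trans (cong (to γ) γa) γa′))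
        (join-spherical sumRot (α ⊎↣ β) (λ c → case conn-⊎₁ c of λ { (_ , () , _) }) (⊎-spherical σ α ρ β sph sph′)))
      where
      γ = (α ⊎↣ β) ↣-∘ transposition a′ x′

      γa : to γ (inj₁ a) ≡ a′
      γa = cong (to (α ⊎↣ β)) (transpose-fix (αa≢a ∘ sym ∘ ⊎ₚ.inj₁-injective) (λ ()))

      γa′ : to γ a′ ≡ inj₂ (to β x)
      γa′ = cong (to (α ⊎↣ β)) (transpose-left a′ x′)

      γβx : to γ (inj₂ (to β x)) ≡ x′
      γβx = trans (cong (to (α ⊎↣ β)) (transpose-fix (λ ()) (βx≢x ∘ ⊎ₚ.inj₂-injective))) (cong inj₂ (β-inv x))

      γ-conjugate : ∀ d → to γ (transpose (inj₁ a) (inj₂ (to β x)) d) ≡ to sumFlip d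
      γ-conjugate d = sym (subst₂ (λ u v → transpose u v (to γ d) ≡ to γ (transpose (inj₁ a) (inj₂ (to β x)) d))
        γa γβx (transpose-conjugate γ (inj₁ a) (inj₂ (to β x)) d))

    sumFlip-involutive : ∀ e → to sumFlip (to sumFlip e) ≡ e
    sumFlip-involutive e = trans
      (cong (transpose a′ x′ ∘ ⊎.map (to α) (to β)) (transpose-involutive a′ x′ _))
      (trans (cong (transpose a′ x′) (involutive₀ _)) (transpose-involutive a′ x′ e))
      where
      involutive₀ : ∀ e → to (α ⊎↣ β) (to (α ⊎↣ β) e) ≡ e
      involutive₀ (inj₁ d) = cong inj₁ (α-inv d)
      involutive₀ (inj₂ z) = cong inj₂ (β-inv z)

    sumFlip-live : (∀ d → to α d ≢ d) → (∀ z → to β z ≢ z) → ∀ e → to sumFlip e ≢ e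
    sumFlip-live α-live β-live e eq = fixed₀ _ (trans (sym (transpose-involutive a′ x′ _)) (cong (transpose a′ x′) eq))
      where
      fixed₀ : ∀ e → to (α ⊎↣ β) e ≢ e
      fixed₀ (inj₁ d) = α-live d ∘ ⊎ₚ.inj₁-injective
      fixed₀ (inj₂ z) = β-live z ∘ ⊎ₚ.inj₂-injective

    sumFlip-outer : ∀ {d} → d ≢ a → d ≢ to α a → to sumFlip (inj₁ d) ≡ inj₁ (to α d)
    sumFlip-outer d≢a d≢αa = trans
      (cong (transpose a′ x′ ∘ to (α ⊎↣ β)) (transpose-fix (d≢αa ∘ ⊎ₚ.inj₁-injective) (λ ())))
      (transpose-fix (d≢a ∘ injective α ∘ ⊎ₚ.inj₁-injective) (λ ()))

    sumFlip-inner : ∀ {z} → z ≢ x → z ≢ to β x → to sumFlip (inj₂ z) ≡ inj₂ (to β z)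
    sumFlip-inner z≢x z≢βx = trans
      (cong (transpose a′ x′ ∘ to (α ⊎↣ β)) (transpose-fix (λ ()) (z≢x ∘ ⊎ₚ.inj₂-injective)))
      (transpose-fix (λ ()) (λ eq → z≢βx (trans (sym (β-inv _)) (cong (to β) (⊎ₚ.inj₂-injective eq)))))

    sumFlip-a : to α a ≢ a → to sumFlip (inj₁ a) ≡ inj₂ x
    sumFlip-a αa≢a = trans
      (cong (transpose a′ x′ ∘ to (α ⊎↣ β)) (transpose-fix (αa≢a ∘ sym ∘ ⊎ₚ.inj₁-injective) (λ ())))
      (transpose-left a′ x′)

    sumFlip-αa : to β x ≢ x → to sumFlip (inj₁ (to α a)) ≡ inj₂ (to β x)
    sumFlip-αa βx≢x = trans (cong (transpose a′ x′ ∘ to (α ⊎↣ β)) (transpose-left a′ x′))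
      (transpose-fix (λ ()) (βx≢x ∘ ⊎ₚ.inj₂-injective))

-- The octahedron

-- (v , i) is the i-th dart in the rotation at v.  The vertices 0, …, 5 are
-- e₁, e₂, e₃, −e₁, −e₂, −e₃, and the dart (0 , 0) points from e₁ to e₂.
OctDart : Set
OctDart = Fin 6 × Fin 4

turn : OctDart → OctDart
turn (v , 0F) = v , 1F
turn (v , 1F) = v , 2F
turn (v , 2F) = v , 3F
turn (v , 3F) = v , 0F

mate : OctDart → OctDart
mate (0F , 0F) = 1F , 0F
mate (0F , 1F) = 2F , 0F
mate (0F , 2F) = 4F , 0F
mate (0F , 3F) = 5F , 0F
mate (1F , 0F) = 0F , 0F
mate (1F , 1F) = 5F , 3F
mate (1F , 2F) = 3F , 0F
mate (1F , 3F) = 2F , 1F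
mate (2F , 0F) = 0F , 1F
mate (2F , 1F) = 1F , 3F
mate (2F , 2F) = 3F , 3F
mate (2F , 3F) = 4F , 1F
mate (3F , 0F) = 1F , 2F
mate (3F , 1F) = 5F , 2F
mate (3F , 2F) = 4F , 2F
mate (3F , 3F) = 2F , 2F
mate (4F , 0F) = 0F , 2F
mate (4F , 1F) = 2F , 3F
mate (4F , 2F) = 3F , 2F
mate (4F , 3F) = 5F , 1F
mate (5F , 0F) = 0F , 3F
mate (5F , 1F) = 4F , 3F
mate (5F , 2F) = 3F , 1F
mate (5F , 3F) = 1F , 1F

private
  -- A numbering of the eight triangles, the orbits of `turn` after `mate`. Row `v` of the table
  -- lists the triangles of the four darts at `v`; `faceDart` picks one dart of each triangle.
  face : OctDart → Fin 8
  face (v , i) = Vec.lookup (Vec.lookup table v) i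
    where
    table : Vec (Vec (Fin 8) 4) 6
    table = (1F ∷ 0F ∷ 2F ∷ 3F ∷ []) ∷ (0F ∷ 1F ∷ 4F ∷ 5F ∷ []) ∷ (2F ∷ 0F ∷ 5F ∷ 6F ∷ [])
          ∷ (5F ∷ 4F ∷ 7F ∷ 6F ∷ []) ∷ (3F ∷ 2F ∷ 6F ∷ 7F ∷ []) ∷ (1F ∷ 3F ∷ 7F ∷ 4F ∷ []) ∷ []

  faceDart : Fin 8 → OctDart
  faceDart = Vec.lookup ((1F , 0F) ∷ (0F , 0F) ∷ (0F , 2F) ∷ (0F , 3F) ∷ (1F , 2F) ∷ (1F , 3F) ∷ (2F , 3F) ∷ (3F , 2F) ∷ [])

turn-order : ∀ d → iter turn 4 d ≡ d
turn-order = from-yes (all-dec λ d → iter turn 4 d ≟ d)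

mate-involutive : ∀ d → mate (mate d) ≡ d
mate-involutive = from-yes (all-dec λ d → mate (mate d) ≟ d)

mate-live : ∀ d → mate d ≢ d
mate-live = from-yes (all-dec λ d → ¬? (mate d ≟ d))

octRot octFlip : OctDart ↣ OctDart
octRot = mk↣ λ {d} {e} eq → trans (sym (turn-order d)) (trans (cong (iter turn 3) eq) (turn-order e))
octFlip = involution {α = mate} mate-involutive

private
  -- `π` numbers the orbits and `s` picks a dart in each. The iterates 0 to 3 suffice for the orbits
  -- in question, which are vertices of four darts and triangles of three, so all hypotheses become
  -- finite checks.
  orbitCount : ∀ {k} (f : OctDart ↣ OctDart) (π : OctDart → Fin k) (s : Fin k → OctDart) →
    (∀ d → π (to f d) ≡ π d) → (∀ j → π (s j) ≡ j) →
    (∀ d → ∃ λ (i : Fin 4) → iter (to f) (toℕ i) (s (π d)) ≡ d) →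
    Global.orbits OctDart f ≡ k
  orbitCount f π s invariant section reached = numClasses-unique (reach-isEquivalence f)
    (Global.#-spec OctDart (reach-isDecEquivalence f))
    (numClasses-retract {S = _≡_} {Q = λ _ → ⊤} (reach-isEquivalence f) π s (λ _ → tt) (λ _ → tt)
      (λ {j} {j′} r → trans (sym (section j)) (trans
        (reach-closed {P = λ d → π (s j) ≡ π d} (λ {d} eq → trans eq (sym (invariant d))) refl r) (section j′)))
      (λ { refl → reach-refl }) (λ {d} _ → let i , eq = reached d in toℕ i , eq)
      (allFin _ , Listₚ.length-tabulate id , All.universal _ _ ,
        AllPairs.map id (Uniqueₚ.allFin⁺ _) , λ j _ → Any.map sym (complete j)))

  reached? : ∀ {k} (f : OctDart ↣ OctDart) (π : OctDart → Fin k) (s : Fin k → OctDart) →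
    Dec (∀ d → ∃ λ (i : Fin 4) → iter (to f) (toℕ i) (s (π d)) ≡ d)
  reached? f π s = all-dec λ d → any-dec λ i → iter (to f) (toℕ i) (s (π d)) ≟ d

oct-faces : Global.orbits OctDart (octRot ↣-∘ octFlip) ≡ 8
oct-faces = orbitCount (octRot ↣-∘ octFlip) face faceDart
  (from-yes (all-dec λ d → face (turn (mate d)) ≟ face d)) (from-yes (all-dec λ j → face (faceDart j) ≟ j))
  (from-yes (reached? (octRot ↣-∘ octFlip) face faceDart))

oct-vertices : Global.orbits OctDart octRot ≡ 6
oct-vertices = orbitCount octRot proj₁ (_, 0F) (from-yes (all-dec λ d → proj₁ (turn d) ≟ proj₁ d)) (λ _ → refl)
  (from-yes (reached? octRot proj₁ (_, 0F)))

oct-darts : Global.size OctDart ≡ 24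
oct-darts = numClasses-unique isEquivalence (Global.#-spec OctDart ≡-isDecEquivalence)
  (elements , refl , All.universal _ _ ,
   Uniqueₚ.cartesianProduct⁺ (Uniqueₚ.allFin⁺ 6) (Uniqueₚ.allFin⁺ 4) , λ d _ → Any.map sym (complete d))

oct-edges : Global.orbits OctDart octFlip + Global.orbits OctDart octFlip ≡ 24
oct-edges = trans (numClasses-unique isEquivalence
  (numDarts octFlip mate-involutive (λ _ → tt) (λ {d} _ → mate-live d) (Global.#-spec OctDart (reach-isDecEquivalence octFlip)))
  (Global.#-spec OctDart ≡-isDecEquivalence)) oct-darts

oct-connected : Global.components OctDart octRot octFlip ≡ 1
oct-connected = numClasses-unique (conn-isEquivalence octRot octFlip)
  (Global.#-spec OctDart (conn-isDecEquivalence octRot octFlip))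
  ((0F , 0F) ∷ [] , refl , tt ∷ [] , [] ∷ [] , λ d _ → here (connected d))
  where
  turned : ∀ {x v} → Conn turn mate x (v , 0F) → ∀ i → Conn turn mate x (v , i)
  turned c 0F = c
  turned c 1F = stepσ c
  turned c 2F = stepσ (stepσ c)
  turned c 3F = stepσ (stepσ (stepσ c))

  connected : ∀ d → Conn turn mate (0F , 0F) d
  connected (0F , i) = turned here i
  connected (1F , i) = turned (stepα here) i
  connected (2F , i) = turned (stepα (turned here 1F)) i
  connected (3F , i) = turned (stepα (turned (stepα here) 2F)) i
  connected (4F , i) = turned (stepα (turned here 2F)) i
  connected (5F , i) = turned (stepα (turned here 3F)) i

oct-spherical : Global.Spherical OctDart octRot octFlip
oct-spherical = begin
  orbits octRot + orbits octFlip + orbits (octRot ↣-∘ octFlip)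
    ≡⟨ cong₂ (λ v f → v + orbits octFlip + f) oct-vertices oct-faces ⟩
  -- Six vertices, twelve edges and eight triangles against 24 darts and one component: 6 + 12 + 8 =
  -- 24 + 2.
  6 + orbits octFlip + 8 ≡⟨ cong (λ e → 6 + e + 8) (half oct-edges) ⟩
  26 ≡⟨ cong₂ (λ n c → n + (c + c)) oct-darts oct-connected ⟨
  size + (components octRot octFlip + components octRot octFlip) ∎
  where
  open Global OctDart
  open ≡-Reasoning
  half : ∀ {e} → e + e ≡ 24 → e ≡ 12
  half {e} eq = ℕₚ.*-cancelˡ-≡ e 12 2 (trans (cong (e +_) (ℕₚ.+-identityʳ e)) eq)

-- Replacing edges by octahedra

numClasses-≡-image : ∀ {A B : Set} {P : A → Set} {Q : B → Set} {k} (h : A → B) → (∀ {x y} → h x ≡ h y → x ≡ y) →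
  (∀ {x} → P x → Q (h x)) → (∀ {y} → Q y → ∃ λ x → P x × h x ≡ y) →
  NumClasses _≡_ P k → NumClasses _≡_ Q k
numClasses-≡-image h h-injective to-Q from-Q (L , refl , inP , ap , cover) =
  map h L , Listₚ.length-map h L , Allₚ.map⁺ (All.map to-Q inP) ,
  AllPairsₚ.map⁺ (AllPairs.map (_∘ h-injective) ap) , λ y qy → found (from-Q qy)
  where
  found : ∀ {y} → (∃ λ x → _ × h x ≡ y) → Any (_≡ y) (map h L)
  found (x , px , refl) = Anyₚ.map⁺ (Any.map (cong h) (cover x px))

turn-vertex : ∀ z → proj₁ (turn z) ≡ proj₁ z
turn-vertex (_ , 0F) = refl
turn-vertex (_ , 1F) = refl
turn-vertex (_ , 2F) = refl
turn-vertex (_ , 3F) = refl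

turn-transitive : ∀ v i j → Reach turn (v , i) (v , j)
turn-transitive v i j = reach-trans (reach-sym octRot (from-zero i)) (from-zero j)
  where
  from-zero : ∀ i → Reach turn (v , 0F) (v , i)
  from-zero 0F = 0 , refl
  from-zero 1F = 1 , refl
  from-zero 2F = 2 , refl
  from-zero 3F = 3 , refl

oct-loopless : ∀ z → proj₁ z ≢ proj₁ (mate z)
oct-loopless = from-yes (all-dec λ z → ¬? (proj₁ z ≟ proj₁ (mate z)))

oct-noparallel : ∀ v i j → proj₁ (mate (v , i)) ≡ proj₁ (mate (v , j)) → i ≡ j
oct-noparallel = from-yes (all-dec λ v → all-dec λ i → all-dec λ j →
  (proj₁ (mate (v , i)) ≟ proj₁ (mate (v , j))) →-dec (i ≟ j))

module _ ⦃ _ : Finite D ⦄ (M : PlanarMap D N) where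
  open PlanarMap M

  On : List D → D → Set
  On L d = Any (λ r → d ≡ r ⊎ d ≡ to flip r) L

  -- The invariant of the replacement, where `L` holds darts of the edges still to be replaced. For
  -- empty `L` it is simplicity.
  record SimpleOff (L : List D) : Set where
    field
      loopless   : ∀ {d} → ¬ On L d → vertex d ≢ vertex (to flip d)
      noparallel : ∀ {d e} → ¬ On L d → ¬ On L e → vertex d ≡ vertex e →
                   vertex (to flip d) ≡ vertex (to flip e) → d ≡ e

module ReplaceEdge {D : Set} ⦃ fin : Finite D ⦄ (M : PlanarMap D N)
                   (all-live : ∀ d → PlanarMap.Live M d) (a : D) where
  open PlanarMap M

  private
    -- The octahedron is opened along its edge between the vertices `0F` and `1F`: `a` is matched
    -- with the dart `(0F , 0F)`, and the other end of the edge with `(1F , 0F)`.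
    open module Sum = ConnectedSum rot flip octRot octFlip flip-involutive mate-involutive a (0F , 0F)

    -- The vertex before it is coded in `Fin (6 + N)`, so that old and new vertices are told apart
    -- by constructors.
    place : D ⊎ OctDart → Fin 6 ⊎ Fin N
    place (inj₁ d) = inj₂ (vertex d)
    place (inj₂ z) = inj₁ (proj₁ z)

    vertex′ : D ⊎ OctDart → Fin (6 + N)
    vertex′ e = join 6 N (place e)

    join-injective : ∀ p q → join 6 N p ≡ join 6 N q → p ≡ q
    join-injective p q eq = trans (sym (Finₚ.splitAt-join 6 N p))
      (trans (cong (splitAt 6) eq) (Finₚ.splitAt-join 6 N q))

    place-≡ : ∀ {e e′} → vertex′ e ≡ vertex′ e′ → place e ≡ place e′
    place-≡ {e} {e′} = join-injective (place e) (place e′)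

    live′ : ∀ e → to sumFlip e ≢ e
    live′ = sumFlip-live all-live mate-live

  replaced : PlanarMap (D ⊎ OctDart) (6 + N)
  replaced = record
    { rot = sumRot
    ; flip = sumFlip
    ; vertex = vertex′
    ; flip-involutive = sumFlip-involutive
    ; rot-live = λ _ → live′ _
    ; rot-vertex = λ { (inj₁ d) → cong (join 6 N ∘ inj₂) (rot-vertex d)
                     ; (inj₂ z) → cong (join 6 N ∘ inj₁) (turn-vertex z) }
    ; rot-transitive = λ {d} {e} _ _ eq → transitive d e (place-≡ {d} {e} eq)
    ; spherical = sum-spherical (all-live a) (λ ()) spherical oct-spherical }
    where
    transitive : ∀ d e → place d ≡ place e → Reach (to sumRot) d e
    transitive (inj₁ d) (inj₁ e) eq =
      reach-inj₁ (rot-transitive (all-live d) (all-live e) (⊎ₚ.inj₂-injective eq))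
    transitive (inj₂ (v , i)) (inj₂ (_ , j)) refl = reach-inj₂ (turn-transitive v i j)

  replaced-live : ∀ e → PlanarMap.Live replaced e
  replaced-live = live′

  -- The rotation is the disjoint union of the two rotations and only the flip mixes them, so every
  -- vertex keeps its four darts.
  replaced-valency : (∀ w → Valency w 4) → ∀ w → PlanarMap.Valency replaced w 4
  replaced-valency valency w = subst (λ w → PlanarMap.Valency replaced w 4) (Finₚ.join-splitAt 6 N w)
    (at (splitAt 6 w))
    where
    at : ∀ p → PlanarMap.Valency replaced (join 6 N p) 4
    at (inj₁ v) = numClasses-≡-image (λ i → inj₂ (v , i)) (λ { refl → refl }) (λ _ → live′ _ , refl)
      (λ { {inj₁ d} (_ , eq) → case join-injective (inj₂ (vertex d)) (inj₁ v) eq of λ ()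
         ; {inj₂ (v′ , i)} (_ , eq) → i , tt ,
             cong (λ v → inj₂ (v , i)) (sym (⊎ₚ.inj₁-injective (join-injective (inj₁ v′) (inj₁ v) eq))) })
      (allFin 4 , refl , All.universal _ _ , Uniqueₚ.allFin⁺ 4 , λ i _ → Any.map sym (complete i))
    at (inj₂ u) = numClasses-≡-image inj₁ ⊎ₚ.inj₁-injective
      (λ (_ , eq) → live′ _ , cong (join 6 N ∘ inj₂) eq)
      (λ { {inj₁ d} (_ , eq) → d , (all-live d , ⊎ₚ.inj₂-injective (join-injective (inj₂ (vertex d)) (inj₂ u) eq)) , refl
         ; {inj₂ z} (_ , eq) → case join-injective (inj₁ (proj₁ z)) (inj₂ u) eq of λ () })
      (valency u)

  replaced-carries : ∀ {H : Multigraph n} {f : Fin n → Fin N} (c : Carries H M f) →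
    (∀ e → ¬ On M (a ∷ []) (Carries.dart c e)) → Carries H replaced (λ i → 6 ↑ʳ f i)
  replaced-carries c off = record
    { dart = inj₁ ∘ dart
    ; dart-live = λ e → live′ _
    ; dart-source = λ e → cong (6 ↑ʳ_) (dart-source e)
    ; dart-target = λ e → trans (cong vertex′ (flip′ e)) (cong (6 ↑ʳ_) (dart-target e))
    ; dart-injective = dart-injective ∘ ⊎ₚ.inj₁-injective
    ; dart-flip-injective = λ {_} {e′} eq → dart-flip-injective (⊎ₚ.inj₁-injective (trans eq (flip′ e′))) }
    where
    open Carries c
    flip′ : ∀ e → to sumFlip (inj₁ (dart e)) ≡ inj₁ (to flip (dart e))
    flip′ e = sumFlip-outer (λ eq → off e (here (inj₁ eq))) (λ eq → off e (here (inj₂ eq)))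

  module _ (L : List D) where

    -- Used in contraposition: an old edge off the remaining list was off `a ∷ L` before, where
    -- simplicity is already known.
    On-replaced : ∀ {d} → d ≢ a → d ≢ to flip a → On M (a ∷ L) d → On replaced (map inj₁ L) (inj₁ d)
    On-replaced d≢a d≢fa (here (inj₁ eq)) = contradiction eq d≢a
    On-replaced d≢a d≢fa (here (inj₂ eq)) = contradiction eq d≢fa
    On-replaced {d} d≢a d≢fa (there p) = Anyₚ.map⁺ (Any.map same p)
      where
      same : ∀ {r} → d ≡ r ⊎ d ≡ to flip r → inj₁ d ≡ inj₁ r ⊎ inj₁ d ≡ to sumFlip (inj₁ r)
      same (inj₁ eq) = inj₁ (cong inj₁ eq)
      same (inj₂ eq) = inj₂ (trans (cong inj₁ eq) (sym (sumFlip-outer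
        (λ r≡a → d≢fa (trans eq (cong (to flip) r≡a)))
        (λ r≡fa → d≢a (trans eq (trans (cong (to flip) r≡fa) (flip-involutive a)))))))

    On-replaced⁻ : ∀ {d} → On replaced (map inj₁ L) (inj₁ d) → On M (a ∷ L) d
    On-replaced⁻ {d} p = there (Any.map (⊎.map ⊎ₚ.inj₁-injective same) (Anyₚ.map⁻ p))
      where
      same : ∀ {r} → inj₁ d ≡ to sumFlip (inj₁ r) → d ≡ to flip r
      same {r} eq = by-cases (r ≟ a) (r ≟ to flip a) eq
        where
        by-cases : ∀ {r} → Dec (r ≡ a) → Dec (r ≡ to flip a) → inj₁ d ≡ to sumFlip (inj₁ r) → d ≡ to flip r
        -- The list may meet the opened edge again; the new flip of either of its darts lies in the
        -- octahedron and so is no old dart.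
        by-cases (yes refl) _ eq = case trans eq (sumFlip-a (all-live a)) of λ ()
        by-cases (no _) (yes refl) eq = case trans eq (sumFlip-αa λ ()) of λ ()
        by-cases (no r≢a) (no r≢fa) eq = ⊎ₚ.inj₁-injective (trans eq (sumFlip-outer r≢a r≢fa))

    private
      port : Bool → D
      port b = if b then to flip a else a

      -- The shapes of a dart together with its new flip. The two connecting edges are `enter` when
      -- left from the old vertex and `leave` when left from the octahedron; the boolean tells which
      -- end of the replaced edge is meant.
      data Edge : D ⊎ OctDart → D ⊎ OctDart → Set where
        old   : ∀ {d} → d ≢ a → d ≢ to flip a → Edge (inj₁ d) (inj₁ (to flip d))
        enter : ∀ b → Edge (inj₁ (port b)) (inj₂ ((if b then 1F else 0F) , 0F))
        leave : ∀ b → Edge (inj₂ ((if b then 1F else 0F) , 0F)) (inj₁ (port b))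
        inner : ∀ z → Edge (inj₂ z) (inj₂ (mate z))

      edge : ∀ e → Edge e (to sumFlip e)
      edge (inj₁ d) = by-cases (d ≟ a) (d ≟ to flip a)
        where
        by-cases : ∀ {d} → Dec (d ≡ a) → Dec (d ≡ to flip a) → Edge (inj₁ d) (to sumFlip (inj₁ d))
        by-cases (yes refl) _ = subst (Edge _) (sym (sumFlip-a (all-live a))) (enter false)
        by-cases (no _) (yes refl) = subst (Edge _) (sym (sumFlip-αa λ ())) (enter true)
        by-cases (no d≢a) (no d≢fa) = subst (Edge _) (sym (sumFlip-outer d≢a d≢fa)) (old d≢a d≢fa)
      edge (inj₂ z) = by-cases (z ≟ (0F , 0F)) (z ≟ (1F , 0F))
        where
        by-cases : ∀ {z} → Dec (z ≡ (0F , 0F)) → Dec (z ≡ (1F , 0F)) → Edge (inj₂ z) (to sumFlip (inj₂ z))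
        by-cases (yes refl) _ = subst (Edge _)
          (trans (sym (sumFlip-involutive (inj₁ a))) (cong (to sumFlip) (sumFlip-a (all-live a)))) (leave false)
        by-cases (no _) (yes refl) = subst (Edge _)
          (trans (sym (sumFlip-involutive (inj₁ (to flip a)))) (cong (to sumFlip) (sumFlip-αa λ ()))) (leave true)
        by-cases (no z≢x) (no z≢y) = subst (Edge _) (sym (sumFlip-inner z≢x z≢y)) (inner _)

      terminal-injective : ∀ b c → _≡_ {A = Fin 6} (if b then 1F else 0F) (if c then 1F else 0F) → b ≡ c
      terminal-injective false false _ = refl
      terminal-injective true true _ = refl

    replaced-simpleOff : SimpleOff M (a ∷ L) → SimpleOff replaced (map inj₁ L)
    replaced-simpleOff simple = record
      { loopless = λ {e} off eq → loop (edge e) off (place-≡ {e} {to sumFlip e} eq)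
      ; noparallel = λ {e} {e′} off off′ eq eqf → parallel (edge e) (edge e′) off off′
          (place-≡ {e} {e′} eq) (place-≡ {to sumFlip e} {to sumFlip e′} eqf) }
      where
      open SimpleOff simple
      Off : D ⊎ OctDart → Set
      Off e = ¬ On replaced (map inj₁ L) e

      loop : ∀ {e u} → Edge e u → Off e → place e ≢ place u
      loop (old d≢a d≢fa) off eq = loopless (off ∘ On-replaced d≢a d≢fa) (⊎ₚ.inj₂-injective eq)
      loop (enter b) _ ()
      loop (leave b) _ ()
      loop (inner z) _ eq = oct-loopless z (⊎ₚ.inj₁-injective eq)

      parallel : ∀ {e u e′ u′} → Edge e u → Edge e′ u′ → Off e → Off e′ →
        place e ≡ place e′ → place u ≡ place u′ → e ≡ e′
      parallel (old d≢a d≢fa) (old e≢a e≢fa) off off′ eq eqf = cong inj₁ (noparallel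
        (off ∘ On-replaced d≢a d≢fa) (off′ ∘ On-replaced e≢a e≢fa) (⊎ₚ.inj₂-injective eq) (⊎ₚ.inj₂-injective eqf))
      -- The old ends may coincide, when the replaced edge was a loop; the two connecting edges are
      -- separated by their ends in the octahedron, `0F` and `1F`.
      parallel (enter b) (enter c) _ _ _ eqf = cong (inj₁ ∘ port) (terminal-injective b c (⊎ₚ.inj₁-injective eqf))
      parallel (leave b) (leave c) _ _ eq _ = cong (λ v → inj₂ (v , 0F)) (⊎ₚ.inj₁-injective eq)
      parallel (inner (v , i)) (inner (_ , j)) _ _ refl eqf =
        cong (λ i → inj₂ (v , i)) (oct-noparallel v i j (⊎ₚ.inj₁-injective eqf))
      parallel (old _ _) (enter _) _ _ _ ()
      parallel (enter _) (old _ _) _ _ _ ()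
      parallel (leave _) (inner _) _ _ _ ()
      parallel (inner _) (leave _) _ _ _ ()

-- The recursion is on the length: the remaining list is mapped into a larger type of darts and is
-- not a part of the old one.
replaceAll : ∀ k {D} ⦃ _ : Finite D ⦄ {H : Multigraph n} (M : PlanarMap D N) (f : Fin n → Fin N) →
  Injective _≡_ _≡_ f → (∀ d → PlanarMap.Live M d) → (∀ w → PlanarMap.Valency M w 4) →
  (c : Carries H M f) → ∀ L → length L ≡ k → (∀ e → ¬ On M L (Carries.dart c e)) → SimpleOff M L →
  Σ ℕ λ N → Σ (Multigraph N) λ G → Simple G × Regular 4 G × Planar G × Subgraph H G
replaceAll {N = N} zero M f f-injective live valency carries [] _ off simple =
  N , T.graph , T.simple (λ _ → loopless λ ()) (λ _ _ → noparallel (λ ()) (λ ())) ,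
  (λ i → T.degree-valency (valency i)) , T.planar , T.subgraph f f-injective carries
  where
  module T = ToMultigraph M id id (λ _ → _ , refl)
  open SimpleOff simple
replaceAll (suc k) M f f-injective live valency carries (a ∷ L) size off simple =
  replaceAll k R.replaced (λ i → 6 ↑ʳ f i) (λ eq → f-injective (Finₚ.↑ʳ-injective 6 _ _ eq)) R.replaced-live
    (R.replaced-valency valency)
    (R.replaced-carries carries λ e → λ { (here p) → off e (here p) })
    (map inj₁ L) (trans (Listₚ.length-map inj₁ L) (ℕₚ.suc-injective size)) (λ e → off e ∘ R.On-replaced⁻ L) (R.replaced-simpleOff L simple)
  where module R = ReplaceEdge M live a

-- Simplicity inherited from `H`, and the equivalence

sameEnds-sym : ∀ {p q : Fin n × Fin n} → SameEnds p q → SameEnds q p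
sameEnds-sym (inj₁ (refl , refl)) = inj₁ (refl , refl)
sameEnds-sym (inj₂ (refl , refl)) = inj₂ (refl , refl)

sameEnds-trans : ∀ {p q r : Fin n × Fin n} → SameEnds p q → SameEnds q r → SameEnds p r
sameEnds-trans (inj₁ (refl , refl)) s = s
sameEnds-trans (inj₂ (refl , refl)) (inj₁ (refl , refl)) = inj₂ (refl , refl)
sameEnds-trans (inj₂ (refl , refl)) (inj₂ (refl , refl)) = inj₁ (refl , refl)

sameEnds-dart : (G : Multigraph n) → ∀ d → SameEnds (ends G (proj₁ d)) (head G d , head G (α G d))
sameEnds-dart G (e , false) = inj₁ (refl , refl)
sameEnds-dart G (e , true) = inj₂ (refl , refl)

sameEnds-reflect : ∀ (f : Fin n → Fin N) → Injective _≡_ _≡_ f → ∀ {a b c d} →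
  SameEnds (f a , f b) (f c , f d) → SameEnds (a , b) (c , d)
sameEnds-reflect f f-injective (inj₁ (p , q)) = inj₁ (f-injective p , f-injective q)
sameEnds-reflect f f-injective (inj₂ (p , q)) = inj₂ (f-injective p , f-injective q)

-- `L` has one dart on each edge outside the image of `g`. A dart off `L` therefore belongs to an
-- edge of `H`, and a loop or a parallel pair among such edges would pull back along the injection
-- `f` to one in `H`.
extendToSimple : ∀ (H : Multigraph n) → Simple H → (G : Multigraph N) → Regular 4 G → Planar G → Subgraph H G →
  Σ ℕ λ N → Σ (Multigraph N) λ G → Simple G × Regular 4 G × Planar G × Subgraph H G
extendToSimple H (H-loopless , H-noparallel) G regular planar sub@(f , f-injective , g , g-injective , same) =
  replaceAll (length L) M f f-injective (toPlanarMap-live G planar) (λ w → toPlanarMap-valency G planar (regular w))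
    carries L refl off simpleOff
  where
  M = toPlanarMap G planar
  carries = toPlanarMap-carries G planar sub

  outside? : Decidable (λ e → ¬ ∃ λ e₀ → g e₀ ≡ e)
  outside? e = ¬? (any-dec λ e₀ → g e₀ ≟ e)

  L : List (Dart G)
  L = map (_, false) (filter outside? (allFin (m G)))

  On⇒outside : ∀ {d} → On M L d → ¬ ∃ λ e₀ → g e₀ ≡ proj₁ d
  On⇒outside {d} on (e₀ , eq) =
    let e , e∈ , d~e = find (Anyₚ.map⁻ on)
    in proj₂ (Memₚ.∈-filter⁻ outside? {xs = allFin (m G)} e∈) (e₀ , trans eq (edge d~e))
    where
    edge : ∀ {e} → d ≡ (e , false) ⊎ d ≡ (e , true) → proj₁ d ≡ e
    edge (inj₁ eq) = cong proj₁ eq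
    edge (inj₂ eq) = cong proj₁ eq

  off⇒inside : ∀ {d} → ¬ On M L d → ∃ λ e₀ → g e₀ ≡ proj₁ d
  off⇒inside {d} off = decidable-stable (any-dec λ e₀ → g e₀ ≟ proj₁ d) λ none →
    off (Anyₚ.map⁺ (lose (Memₚ.∈-filter⁺ outside? (complete (proj₁ d)) none) (side d)))
    where
    side : ∀ d → d ≡ (proj₁ d , false) ⊎ d ≡ (proj₁ d , true)
    side (_ , false) = inj₁ refl
    side (_ , true) = inj₂ refl

  off : ∀ e → ¬ On M L (Carries.dart carries e)
  off e on = On⇒outside on (e , refl)

  dart-ends : ∀ d e₀ → g e₀ ≡ proj₁ d →
    SameEnds (f (proj₁ (ends H e₀)) , f (proj₂ (ends H e₀))) (head G d , head G (α G d))
  dart-ends d e₀ refl = sameEnds-trans (same e₀) (sameEnds-dart G d)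

  loopless : ∀ {d} → ¬ On M L d → head G d ≢ head G (α G d)
  loopless {d} off eq with off⇒inside off
  ... | e₀ , ge₀ with dart-ends d e₀ ge₀
  ...   | inj₁ (p , q) = H-loopless e₀ (f-injective (trans p (trans eq (sym q))))
  ...   | inj₂ (p , q) = H-loopless e₀ (f-injective (trans p (trans (sym eq) (sym q))))

  -- Opposite darts of one edge with a common head would make the edge a loop.
  same-side : ∀ {d d′} → ¬ On M L d → proj₁ d ≡ proj₁ d′ → head G d ≡ head G d′ → d ≡ d′
  same-side {_ , false} {_ , false} _ refl _ = refl
  same-side {_ , true} {_ , true} _ refl _ = refl
  same-side {_ , false} {_ , true} off refl eq = contradiction eq (loopless off)
  same-side {_ , true} {_ , false} off refl eq = contradiction eq (loopless off)

  noparallel : ∀ {d d′} → ¬ On M L d → ¬ On M L d′ → head G d ≡ head G d′ → head G (α G d) ≡ head G (α G d′) → d ≡ d′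
  noparallel {d} {d′} off off′ eq eqα with off⇒inside off | off⇒inside off′
  ... | e₀ , p | e₀′ , p′ = same-side off (trans (sym p) (trans (cong g e₀≡e₀′) p′)) eq
    where
    e₀≡e₀′ : e₀ ≡ e₀′
    e₀≡e₀′ = decidable-stable (e₀ ≟ e₀′) λ e₀≢e₀′ → H-noparallel e₀ e₀′ e₀≢e₀′
      (sameEnds-reflect f f-injective (sameEnds-trans
        (subst₂ (λ u v → SameEnds _ (u , v)) eq eqα (dart-ends d e₀ p)) (sameEnds-sym (dart-ends d′ e₀′ p′))))

  simpleOff : SimpleOff M L
  simpleOff = record
    { loopless = λ {d} → loopless {d}
    ; noparallel = λ {d} {d′} → noparallel {d} {d′} }

theorem17p4 : (n : ℕ) (H : Multigraph n) →
    Simple H → Planar H → MaxDegreeAtMost 4 H →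
    (Σ ℕ λ N → Σ (Multigraph N) λ G →
    Simple G × Regular 4 G × Planar G × Subgraph H G)
    ⇔
    (Σ (Multigraph n) λ G′ →
    Regular 4 G′ × Planar G′ × Subgraph H G′)
theorem17p4 n H simple _ _ = mk⇔
  (λ (_ , G , _ , regular , planar , sub) → restrictToSubgraph H G regular planar sub)
  (λ (G′ , regular , planar , sub) → extendToSimple H simple G′ regular planar sub)
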